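{- Let $q$ be any prime power and let $a,b$ be distinct positive integers with $a\mid b$ and $b\mid (q-1)$. Then $\mathscr{C}_a(q)\neq\mathscr{C}_b(q)$, except in the following cases, where equality holds: $(q,a,b)\in\{(3,1,2),\,(4,1,3),\,(5,1,2),\,(5,1,4),\,(5,2,4),\,(7,1,3)\}$ (that is, $\mathscr{C}_1(3)=\mathscr{C}_2(3)$, $\mathscr{C}_1(4)=\mathscr{C}_3(4)$, $\mathscr{C}_1(5)=\mathscr{C}_2(5)=\mathscr{C}_4(5)$ and $\mathscr{C}_1(7)=\mathscr{C}_3(7)$).
   Context: Let $\mathbb{F}_q$ be the finite field of order $q$. An orthomorphism over $\mathbb{F}_q$ is a permutation $\theta$ of $\mathbb{F}_q$ such that $x\mapsto\theta(x)-x$ is also a permutation of $\mathbb{F}_q$. For a positive integer $k$ dividing $q-1$, fix a generator $g$ of the cyclic group $\mathbb{F}_q^*$ and let the cyclotomy classes of index $k$ be $C_{k,i}=\{g^j : j\equiv i \pmod k\}$ for $0\le i<k$ (so $C_{k,0}$ is the unique subgroup of index $k$ in $\mathbb{F}_q^*$ and the $C_{k,i}$ are its cosets). A cyclotomic map of index $k$ with multipliers $[a_0,\dots,a_{k-1}]$ ($a_i\in\mathbb{F}_q$) is the map $\theta(0)=0$, $\theta(x)=a_ix$ for $x\in C_{k,i}$. A cyclotomic orthomorphism of index $k$ is an orthomorphism that is a cyclotomic map of index $k$, and $\mathscr{C}_k(q)$ denotes the set of all cyclotomic orthomorphisms of index $k$ over $\mathbb{F}_q$. -}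

module Defs where

open import Data.Nat using (ℕ; zero; suc; _^_; NonZero)
open import Data.Nat.DivMod using (_mod_)
open import Data.Nat.Primality using (Prime)
open import Data.Fin using (Fin)
open import Data.Product using (Σ; ∃; _×_; _,_)
open import Data.Sum using (_⊎_)
open import Algebra.Structures using (IsCommutativeRing)
open import Relation.Binary.PropositionalEquality using (_≡_; _≢_)
open import Function.Definitions using (Bijective)
open import Function.Bundles using (_⇔_)

IsPrimePower : ℕ → Set
IsPrimePower q = Σ ℕ λ p → Σ ℕ λ m → Prime p × q ≡ p ^ suc m

-- A finite field with exactly q elements, its carrier being Fin q
-- (every finite set of size q is in bijection with Fin q).
record FiniteField (q : ℕ) : Set where
  field
    _+_ _*_ : Fin q → Fin q → Fin q
    -_      : Fin q → Fin q
    0# 1#   : Fin q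
    isCommutativeRing : IsCommutativeRing _≡_ _+_ _*_ -_ 0# 1#
    0≢1     : 0# ≢ 1#
    inverse : ∀ x → x ≢ 0# → Σ (Fin q) λ y → x * y ≡ 1#

  infixl 6 _+_ _-_
  infixl 7 _*_

  _-_ : Fin q → Fin q → Fin q
  x - y = x + (- y)

  pow : Fin q → ℕ → Fin q
  pow x zero    = 1#
  pow x (suc j) = x * pow x j

  IsGenerator : Fin q → Set
  IsGenerator g = ∀ x → x ≢ 0# → Σ ℕ λ j → pow g j ≡ x

  IsOrthomorphism : (Fin q → Fin q) → Set
  IsOrthomorphism θ = Bijective _≡_ _≡_ θ × Bijective _≡_ _≡_ (λ x → θ x - x)

  -- cyclotomic map of index k w.r.t. generator g, multipliers a₀..a_{k-1}:
  -- θ 0 = 0 and θ x = aᵢ x for x = g^j ∈ C_{k,i}, i.e. j ≡ i (mod k)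
  IsCyclotomicMap : (g : Fin q) (k : ℕ) .{{_ : NonZero k}} → (Fin q → Fin q) → Set
  IsCyclotomicMap g k θ =
    Σ (Fin k → Fin q) λ a →
      (θ 0# ≡ 0#) × (∀ (j : ℕ) → θ (pow g j) ≡ a (j mod k) * pow g j)

  IsCyclotomicOrthomorphism : (g : Fin q) (k : ℕ) .{{_ : NonZero k}} → (Fin q → Fin q) → Set
  IsCyclotomicOrthomorphism g k θ = IsOrthomorphism θ × IsCyclotomicMap g k θ

Exceptional : ℕ → ℕ → ℕ → Set
Exceptional q a b =
    (q ≡ 3 × a ≡ 1 × b ≡ 2)
  ⊎ (q ≡ 4 × a ≡ 1 × b ≡ 3)
  ⊎ (q ≡ 5 × a ≡ 1 × b ≡ 2)
  ⊎ (q ≡ 5 × a ≡ 1 × b ≡ 4)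
  ⊎ (q ≡ 5 × a ≡ 2 × b ≡ 4)
  ⊎ (q ≡ 7 × a ≡ 1 × b ≡ 3)

{-# OPTIONS --safe #-}
-- Write n = q - 1, w = g ^ a and h = g ^ b. The two sets of orthomorphisms coincide iff every orthomorphism that fixes 0
-- and commutes with multiplication by h also commutes with multiplication by w. Outside the exceptional cases
-- there is one that commutes with h only.
--
-- If h has order n / b at least 3, then the multipliers 1 + h and 1 + h⁻¹ have quotient h, and after subtracting 1
-- they have quotient h². Hence they may be distributed over the cyclotomy classes of index b at will.
--
-- If h = 1 and q is odd, let θ be such a two-valued orthomorphism of index 2. If all its translates
-- x ↦ θ (x + e) - θ e commuted with w, then θ would be additive, but it has two multipliers. In characteristic 2
-- one takes a multiple of the identity shifted outside an additive subgroup {0, 1, α, 1 + α} not containing w.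
--
-- If h = -1, the orthomorphism is x ↦ (x + δ x) / 2 with δ odd and both x ↦ x ± δ x bijective. If some u is not a multiple
-- of 1, then δ = 1 on u + ℤ, δ = -1 on -u + ℤ and δ = 0 elsewhere. Otherwise the field is ℤ/q with q prime to 3, and
-- δ is supported on ±[1, t + 1] for t = ⌊q/3⌋. In both cases some x has δ (w x) ≢ w δ x, because w is not ±1.
module Submission where

open import Defs
open import Algebra.Bundles using (CommutativeRing)
open import Algebra.Solver.Ring.AlmostCommutativeRing using (fromCommutativeRing; _-Raw-AlmostCommutative⟶_)
open import Data.Empty using (⊥)
open import Data.Fin as Fin using (Fin; zero; suc; toℕ; fromℕ<; punchOut)
open import Data.Fin.Patterns using (0F; 1F; 2F; 3F; 4F; 5F; 6F)
open import Data.Fin.Permutation using (Permutation; permutation)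
import Data.Fin.Properties as Fin
open import Data.Integer as ℤ using (ℤ; -[1+_])
import Data.Integer.Properties as ℤ
open import Data.Maybe using (Maybe; just; nothing)
open import Data.Nat as ℕ using (ℕ; zero; suc; s≤s; z≤n; _∸_; NonZero)
open import Data.Nat.Coprimality using (prime⇒coprime; coprime-Bézout)
open import Data.Nat.Divisibility using (_∣_; divides; _∣?_; ∣-trans; ∣⇒≤; m∣m*n; ∣m+n∣m⇒∣n; ∣n⇒∣m*n; m%n≡0⇒n∣m)
open import Data.Nat.DivMod using (_mod_; _%_; _/_; m%n<n; m≡m%n+[m/n]*n; [m+n]%n≡m%n)
open import Data.Nat.GCD using (module Bézout)
open import Data.Nat.Primality using (Prime; prime?)
import Data.Nat.Properties as ℕ
open import Data.Product using (∃; _×_; _,_; proj₁; proj₂)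
open import Data.Sum using (_⊎_; inj₁; inj₂; [_,_]′)
open import Data.Vec using (lookup; _∷_; [])
open import Function using (_∘_; id; _⇔_; mk⇔; Equivalence)
open import Function.Definitions using (Injective; StrictlySurjective; Bijective)
open import Level using (0ℓ)
open import Relation.Binary.Definitions using (tri<; tri≈; tri>)
open import Relation.Binary.PropositionalEquality
open import Relation.Nullary using (¬_; Dec; yes; no; contradiction; ¬?; _×-dec_; _⊎-dec_; _→-dec_)
open import Relation.Nullary.Decidable using (from-yes; from-no; map′)
open import Relation.Unary using (Pred; Decidable)

-- Injections and surjections between finite sets.

injective⇒surjective : ∀ {n} {f : Fin n → Fin n} → Injective _≡_ _≡_ f → StrictlySurjective _≡_ f
injective⇒surjective {suc n} {f} inj y with Fin.any? (λ x → f x Fin.≟ y)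
... | yes hit = hit
-- Punching the missed value out of the codomain would inject `suc n` elements into `n`.
... | no miss = contradiction (Fin.injective⇒≤ {f = λ x → punchOut (miss′ x)}
                  (inj ∘ Fin.punchOut-injective (miss′ _) (miss′ _)))
                  ℕ.1+n≰n
  where
  miss′ : ∀ x → y ≢ f x
  miss′ x eq = miss (x , sym eq)

-- A section `s` of `f` is injective, hence surjective by finiteness, and so a two-sided inverse.
surjective⇒injective : ∀ {n} {f : Fin n → Fin n} → StrictlySurjective _≡_ f → Injective _≡_ _≡_ f
surjective⇒injective {n} {f} surj {x} {y} fx≡fy = begin
  x             ≡⟨ section-retract x ⟨
  s (f x)       ≡⟨ cong s fx≡fy ⟩
  s (f y)       ≡⟨ section-retract y ⟩
  y             ∎
  where
  open ≡-Reasoning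
  s : Fin n → Fin n
  s = proj₁ ∘ surj
  s-injective : Injective _≡_ _≡_ s
  s-injective {u} {v} eq = trans (sym (proj₂ (surj u))) (trans (cong f eq) (proj₂ (surj v)))
  section-retract : ∀ z → s (f z) ≡ z
  section-retract z with injective⇒surjective s-injective z
  ... | w , refl = cong s (proj₂ (surj w))

surjective⇒≤ : ∀ {m n} {f : Fin m → Fin n} → StrictlySurjective _≡_ f → n ℕ.≤ m
surjective⇒≤ {f = f} surj = Fin.injective⇒≤ {f = proj₁ ∘ surj}
  λ {u} {v} eq → trans (sym (proj₂ (surj u))) (trans (cong f eq) (proj₂ (surj v)))

missed-value : ∀ {m n} (f : Fin m → Fin n) → m ℕ.< n → ∃ λ y → ∀ x → f x ≢ y
missed-value {m} {n} f m<n with Fin.any? (λ y → Fin.all? (λ x → ¬? (f x Fin.≟ y)))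
... | yes found = found
... | no none = contradiction (surjective⇒≤ {f = f} hit) (ℕ.<⇒≱ m<n)
  where
  hit : StrictlySurjective _≡_ f
  hit y with Fin.any? (λ x → f x Fin.≟ y)
  ... | yes h = h
  ... | no h = contradiction (y , λ x eq → h (x , eq)) none

bijective : ∀ {n} {f : Fin n → Fin n} → Injective _≡_ _≡_ f → Bijective _≡_ _≡_ f
bijective inj = inj , λ y → let x , eq = injective⇒surjective inj y in x , λ { refl → eq }

-- From b ≤ t one would get 1 + 2 b ≤ 3 t < r + 3 t. This places ⌊q/3⌋ strictly below (q - 1) / 2.
third<half : ∀ {t r b} → 1 ℕ.≤ t → 0 ℕ.< r → suc (b ℕ.+ b) ≡ r ℕ.+ t ℕ.* 3 → t ℕ.< b
third<half {t} {r} {b} 1≤t 0<r eq = ℕ.≰⇒> λ b≤t → ℕ.<-irrefl eq (begin-strict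
  suc (b ℕ.+ b)           ≤⟨ s≤s (ℕ.+-mono-≤ b≤t b≤t) ⟩
  suc (t ℕ.+ t)           ≤⟨ ℕ.+-monoˡ-≤ (t ℕ.+ t) 1≤t ⟩
  t ℕ.+ (t ℕ.+ t)         ≡⟨ trans (cong (λ k → t ℕ.+ (t ℕ.+ k)) (sym (ℕ.+-identityʳ t))) (ℕ.*-comm 3 t) ⟩
  t ℕ.* 3                 <⟨ ℕ.m<n+m (t ℕ.* 3) 0<r ⟩
  r ℕ.+ t ℕ.* 3           ∎)
  where open ℕ.≤-Reasoning

proper-divisor-< : ∀ {a b} .{{_ : NonZero b}} → a ≢ b → a ∣ b → a ℕ.< b
proper-divisor-< a≢b a∣b = ℕ.≤∧≢⇒< (∣⇒≤ a∣b) a≢b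

-- Field algebra and the ring solver.

module FieldProperties {q : ℕ} (F : FiniteField q) where

  open FiniteField F
  open ≡-Reasoning

  commutativeRing : CommutativeRing _ _
  commutativeRing = record { isCommutativeRing = isCommutativeRing }

  open CommutativeRing commutativeRing public
    using (semiring; ring; +-abelianGroup; +-commutativeSemigroup; +-commutativeMonoid; +-identityˡ; +-identityʳ; +-comm
          ; *-identityˡ; *-identityʳ; *-comm; *-assoc; zeroˡ; zeroʳ; -‿inverseʳ)
  open import Algebra.Properties.Ring ring public
    using (-‿involutive; -0#≈0#; -‿distribˡ-*; -‿distribʳ-*)
  open import Algebra.Properties.AbelianGroup +-abelianGroup public using (⁻¹-∙-comm)
  open import Algebra.Properties.CommutativeSemigroup +-commutativeSemigroup public using (interchange)
  open import Algebra.Properties.Semiring.Mult semiring public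
    using (×-homo-+; ×1-homo-*) renaming (_×_ to _·_)

  ι : ℕ → Fin q
  ι n = n · 1#

  ιℤ : ℤ → Fin q
  ιℤ (ℤ.+ n)    = ι n
  ιℤ -[1+ n ] = - ι (suc n)

  private
    ACR = fromCommutativeRing commutativeRing

    module Homomorphism where

      ιℤ-⊖ : ∀ m n → ιℤ (m ℤ.⊖ n) ≡ ι m - ι n
      ιℤ-⊖ m zero = sym (trans (cong (ι m +_) -0#≈0#) (+-identityʳ _))
      ιℤ-⊖ zero (suc n) = sym (+-identityˡ _)
      ιℤ-⊖ (suc m) (suc n) = begin
        ιℤ (suc m ℤ.⊖ suc n)          ≡⟨ cong ιℤ (ℤ.[1+m]⊖[1+n]≡m⊖n m n) ⟩
        ιℤ (m ℤ.⊖ n)                  ≡⟨ ιℤ-⊖ m n ⟩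
        ι m - ι n                     ≡⟨ +-identityˡ _ ⟨
        0# + (ι m - ι n)              ≡⟨ cong (_+ (ι m - ι n)) (-‿inverseʳ 1#) ⟨
        (1# - 1#) + (ι m - ι n)       ≡⟨ interchange _ _ _ _ ⟩
        (1# + ι m) + (- 1# + - ι n)   ≡⟨ cong (1# + ι m +_) (⁻¹-∙-comm 1# (ι n)) ⟩
        ι (suc m) - ι (suc n)         ∎

      ιℤ-neg : ∀ i → ιℤ (ℤ.- i) ≡ - ιℤ i
      ιℤ-neg (ℤ.+ zero)  = sym -0#≈0#
      ιℤ-neg (ℤ.+ suc n) = refl
      ιℤ-neg -[1+ n ]  = sym (-‿involutive _)

      ιℤ-+ : ∀ i j → ιℤ (i ℤ.+ j) ≡ ιℤ i + ιℤ j
      ιℤ-+ (ℤ.+ m) (ℤ.+ n) = ×-homo-+ 1# m n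
      ιℤ-+ (ℤ.+ m) -[1+ n ] = ιℤ-⊖ m (suc n)
      ιℤ-+ -[1+ m ] (ℤ.+ n) = trans (ιℤ-⊖ n (suc m)) (+-comm _ _)
      ιℤ-+ -[1+ m ] -[1+ n ] = begin
        - ι (suc (suc (m ℕ.+ n)))     ≡⟨ cong (-_ ∘ ι ∘ suc) (sym (ℕ.+-suc m n)) ⟩
        - ι (suc m ℕ.+ suc n)         ≡⟨ cong -_ (×-homo-+ 1# (suc m) (suc n)) ⟩
        - (ι (suc m) + ι (suc n))     ≡⟨ ⁻¹-∙-comm _ _ ⟨
        - ι (suc m) + - ι (suc n)     ∎

      ιℤ-*-pos : ∀ m j → ιℤ (ℤ.+ m ℤ.* j) ≡ ι m * ιℤ j
      ιℤ-*-pos m (ℤ.+ n) = trans (cong ιℤ (sym (ℤ.pos-* m n))) (×1-homo-* m n)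
      ιℤ-*-pos m -[1+ n ] = begin
        ιℤ (ℤ.+ m ℤ.* -[1+ n ])         ≡⟨ cong ιℤ (sym (ℤ.neg-distribʳ-* (ℤ.+ m) (ℤ.+ suc n))) ⟩
        ιℤ (ℤ.- (ℤ.+ m ℤ.* ℤ.+ suc n))    ≡⟨ ιℤ-neg (ℤ.+ m ℤ.* ℤ.+ suc n) ⟩
        - ιℤ (ℤ.+ m ℤ.* ℤ.+ suc n)        ≡⟨ cong -_ (ιℤ-*-pos m (ℤ.+ suc n)) ⟩
        - (ι m * ι (suc n))           ≡⟨ -‿distribʳ-* _ _ ⟩
        ι m * - ι (suc n)             ∎

      ιℤ-* : ∀ i j → ιℤ (i ℤ.* j) ≡ ιℤ i * ιℤ j
      ιℤ-* (ℤ.+ m) j = ιℤ-*-pos m j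
      ιℤ-* -[1+ m ] j = begin
        ιℤ (ℤ.- (ℤ.+ suc m) ℤ.* j)      ≡⟨ cong ιℤ (sym (ℤ.neg-distribˡ-* (ℤ.+ suc m) j)) ⟩
        ιℤ (ℤ.- (ℤ.+ suc m ℤ.* j))      ≡⟨ ιℤ-neg (ℤ.+ suc m ℤ.* j) ⟩
        - ιℤ (ℤ.+ suc m ℤ.* j)          ≡⟨ cong -_ (ιℤ-*-pos (suc m) j) ⟩
        - (ι (suc m) * ιℤ j)          ≡⟨ -‿distribˡ-* _ _ ⟩
        - ι (suc m) * ιℤ j            ∎

    open Homomorphism

    -- Agrees with ιℤ, but ⟦ 1 ⟧ is 1# itself rather than 1# + 0#.
    ⟦_⟧ : ℤ → Fin q
    ⟦ ℤ.+ 1 ⟧ = 1#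
    ⟦ i ⟧     = ιℤ i

    ⟦⟧≡ιℤ : ∀ i → ⟦ i ⟧ ≡ ιℤ i
    ⟦⟧≡ιℤ (ℤ.+ 0)             = refl
    ⟦⟧≡ιℤ (ℤ.+ 1)             = sym (+-identityʳ 1#)
    ⟦⟧≡ιℤ (ℤ.+ suc (suc n))   = refl
    ⟦⟧≡ιℤ -[1+ n ]            = refl

    ⟦⟧-homo₂ : ∀ (_∙_ : ℤ → ℤ → ℤ) (_∘′_ : Fin q → Fin q → Fin q) →
               (∀ i j → ιℤ (i ∙ j) ≡ ιℤ i ∘′ ιℤ j) →
               ∀ i j → ⟦ i ∙ j ⟧ ≡ ⟦ i ⟧ ∘′ ⟦ j ⟧
    ⟦⟧-homo₂ _∙_ _∘′_ homo i j =
      trans (⟦⟧≡ιℤ (i ∙ j)) (trans (homo i j) (cong₂ _∘′_ (sym (⟦⟧≡ιℤ i)) (sym (⟦⟧≡ιℤ j))))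

    ⟦⟧-morphism : ℤ.+-*-rawRing -Raw-AlmostCommutative⟶ ACR
    ⟦⟧-morphism = record
      { ⟦_⟧ = ⟦_⟧
      ; +-homo = ⟦⟧-homo₂ ℤ._+_ _+_ ιℤ-+
      ; *-homo = ⟦⟧-homo₂ ℤ._*_ _*_ ιℤ-*
      ; -‿homo = λ i → trans (⟦⟧≡ιℤ (ℤ.- i)) (trans (ιℤ-neg i) (cong -_ (sym (⟦⟧≡ιℤ i))))
      ; 0-homo = refl
      ; 1-homo = refl
      }

    ⟦⟧-weakDec : ∀ i j → Maybe (⟦ i ⟧ ≡ ⟦ j ⟧)
    ⟦⟧-weakDec i j with i ℤ.≟ j
    ... | yes refl = just refl
    ... | no _     = nothing

  open import Algebra.Solver.Ring ℤ.+-*-rawRing ACR ⟦⟧-morphism ⟦⟧-weakDec public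
    using (solve; _:=_; _:+_; _:*_; _:-_; :-_; con; Polynomial)

  -- The numeral ι 2 unfolds to 1# + (1# + 0#), and is spelled out in this form in the solver equations.
  :0 :1 : ∀ {k} → Polynomial k
  :0 = con (ℤ.+ 0)
  :1 = con (ℤ.+ 1)

  x-y≡0⇒x≡y : ∀ {x y} → x - y ≡ 0# → x ≡ y
  x-y≡0⇒x≡y {x} {y} eq = begin
    x              ≡⟨ solve 2 (λ x y → x := (x :- y) :+ y) refl x y ⟩
    (x - y) + y    ≡⟨ cong (_+ y) eq ⟩
    0# + y         ≡⟨ +-identityˡ y ⟩
    y              ∎

  -- A certificate for deriving one equation from another: the solver only has to check the
  -- polynomial identity that displays x - y as the multiple `c` of l - r.
  linear-combination : ∀ {x y l r} c → x - y ≡ c * (l - r) → l ≡ r → x ≡ y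
  linear-combination {l = l} c eq refl =
    x-y≡0⇒x≡y (trans eq (solve 2 (λ c l → c :* (l :- l) := :0) refl c l))

  linear-combination₂ : ∀ {x y l r l′ r′} c c′ → x - y ≡ c * (l - r) + c′ * (l′ - r′) → l ≡ r → l′ ≡ r′ → x ≡ y
  linear-combination₂ {l = l} {l′ = l′} c c′ eq refl refl =
    x-y≡0⇒x≡y (trans eq (solve 4 (λ c l c′ l′ → c :* (l :- l) :+ c′ :* (l′ :- l′) := :0) refl c l c′ l′))

  *-cancelˡ : ∀ {x y z} → x ≢ 0# → x * y ≡ x * z → y ≡ z
  *-cancelˡ {x} {y} {z} x≢0 eq with x⁻¹ , x*x⁻¹≡1 ← inverse x x≢0 =
    linear-combination₂ x⁻¹ (z - y)
      (solve 4 (λ x x⁻¹ y z → y :- z := x⁻¹ :* (x :* y :- x :* z) :+ (z :- y) :* (x :* x⁻¹ :- :1)) refl x x⁻¹ y z)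
      eq x*x⁻¹≡1

  zero-product : ∀ {x y} → x * y ≡ 0# → x ≡ 0# ⊎ y ≡ 0#
  zero-product {x} {y} eq with x Fin.≟ 0#
  ... | yes x≡0 = inj₁ x≡0
  ... | no  x≢0 = inj₂ (*-cancelˡ x≢0 (trans eq (sym (zeroʳ x))))

  *-nonzero : ∀ {x y} → x ≢ 0# → y ≢ 0# → x * y ≢ 0#
  *-nonzero x≢0 y≢0 eq with zero-product eq
  ... | inj₁ x≡0 = x≢0 x≡0
  ... | inj₂ y≡0 = y≢0 y≡0

  square-one : ∀ {x} → x * x ≡ 1# → x ≢ 1# → x ≡ - 1#
  square-one {x} eq x≢1 with zero-product {x - 1#} {x + 1#}
    (linear-combination 1# (solve 1 (λ x → (x :- :1) :* (x :+ :1) :- :0 := :1 :* (x :* x :- :1)) refl x) eq)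
  ... | inj₁ x-1≡0 = contradiction (x-y≡0⇒x≡y x-1≡0) x≢1
  ... | inj₂ x+1≡0 = linear-combination 1# (solve 1 (λ x → x :- (:- :1) := :1 :* (x :+ :1 :- :0)) refl x) x+1≡0

  pow-+ : ∀ x i j → pow x (i ℕ.+ j) ≡ pow x i * pow x j
  pow-+ x zero    j = sym (*-identityˡ _)
  pow-+ x (suc i) j = trans (cong (x *_) (pow-+ x i j)) (sym (*-assoc _ _ _))

  pow-* : ∀ x i j → pow x (i ℕ.* j) ≡ pow (pow x j) i
  pow-* x zero    j = refl
  pow-* x (suc i) j = trans (pow-+ x j (i ℕ.* j)) (cong (pow x j *_) (pow-* x i j))

  pow-distrib : ∀ x y i → pow (x * y) i ≡ pow x i * pow y i
  pow-distrib x y zero    = sym (*-identityˡ 1#)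
  pow-distrib x y (suc i) = trans (cong (x * y *_) (pow-distrib x y i))
    (solve 4 (λ x y u v → (x :* y) :* (u :* v) := (x :* u) :* (y :* v)) refl x y (pow x i) (pow y i))

  pow-1 : ∀ i → pow 1# i ≡ 1#
  pow-1 zero    = refl
  pow-1 (suc i) = trans (*-identityˡ _) (pow-1 i)

  pow-nonzero : ∀ {x} → x ≢ 0# → ∀ i → pow x i ≢ 0#
  pow-nonzero x≢0 zero    = 0≢1 ∘ sym
  pow-nonzero x≢0 (suc i) = *-nonzero x≢0 (pow-nonzero x≢0 i)

  orthomorphism : ∀ {θ} → Injective _≡_ _≡_ θ → Injective _≡_ _≡_ (λ x → θ x - x) → IsOrthomorphism θ
  orthomorphism inj inj′ = bijective inj , bijective inj′

  -- Maps that commute with a multiplication.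

  -- For `w` = g ^ k and maps fixing 0 this amounts to being cyclotomic of index k, with no
  -- reference to classes or multipliers.
  Equivariant : Fin q → (Fin q → Fin q) → Set
  Equivariant w θ = ∀ x → θ (w * x) ≡ w * θ x

  equivariant-pow : ∀ {w θ} → Equivariant w θ → ∀ i → Equivariant (pow w i) θ
  equivariant-pow {w} {θ} eqv zero    x = trans (cong θ (*-identityˡ x)) (sym (*-identityˡ (θ x)))
  equivariant-pow {w} {θ} eqv (suc i) x = begin
    θ (w * pow w i * x)       ≡⟨ cong θ (*-assoc w _ x) ⟩
    θ (w * (pow w i * x))     ≡⟨ eqv _ ⟩
    w * θ (pow w i * x)       ≡⟨ cong (w *_) (equivariant-pow eqv i x) ⟩
    w * (pow w i * θ x)       ≡⟨ *-assoc w _ _ ⟨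
    w * pow w i * θ x         ∎

  -- Precomposing with a shift keeps an orthomorphism; subtracting `θ e` makes it fix 0 again.
  translate : (Fin q → Fin q) → Fin q → Fin q → Fin q
  translate θ e x = θ (x + e) - θ e

  translate-0 : ∀ θ e → translate θ e 0# ≡ 0#
  translate-0 θ e = trans (cong (λ x → θ x - θ e) (+-identityˡ e)) (-‿inverseʳ (θ e))

  translate-orthomorphism : ∀ {θ} e → IsOrthomorphism θ → IsOrthomorphism (translate θ e)
  translate-orthomorphism {θ} e ((inj , _) , (inj′ , _)) = orthomorphism
    (λ {x} {y} eq → shift-injective x y (inj (linear-combination 1#
      (solve 3 (λ u v w → u :- v := :1 :* ((u :- w) :- (v :- w))) refl _ _ _) eq)))
    (λ {x} {y} eq → shift-injective x y (inj′ (linear-combination 1#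
      (solve 6 (λ u v w x y e → (u :- (x :+ e)) :- (v :- (y :+ e))
          := :1 :* (((u :- w) :- x) :- ((v :- w) :- y))) refl _ _ (θ e) x y e) eq)))
    where
    shift-injective : ∀ x y → x + e ≡ y + e → x ≡ y
    shift-injective x y = linear-combination 1#
        (solve 3 (λ x y e → x :- y := :1 :* ((x :+ e) :- (y :+ e))) refl x y e)

  -- For `w` = g ^ a this compares the indices a and q - 1, since every map fixing 0 is cyclotomic
  -- of index q - 1.
  AllEquivariant : Fin q → Set
  AllEquivariant w = ∀ θ → IsOrthomorphism θ → θ 0# ≡ 0# → Equivariant w θ

  -- Equivariance of the translate at `e` is the affine identity θ (w (z - e) + e) = w θ z + (1 - w)
  -- θ e. Since `w` and `1# - w` are invertible, `z` and `e` can be chosen with w z = u and (1 - w)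
  -- e = v.
  allEquivariant⇒additive : ∀ {w} → w ≢ 0# → w ≢ 1# → AllEquivariant w →
    ∀ θ → IsOrthomorphism θ → θ 0# ≡ 0# → ∀ u v → θ (u + v) ≡ θ u + θ v
  allEquivariant⇒additive {w} w≢0 w≢1 eqv θ orth θ0≡0 u v = begin
    θ (u + v)                               ≡⟨ cong θ (linear-combination₂ (- u) (- v)
      (solve 5 (λ w w⁻¹ k u v → (u :+ v) :- (w :* (w⁻¹ :* u :- k :* v) :+ k :* v)
        := (:- u) :* (w :* w⁻¹ :- :1) :+ (:- v) :* ((:1 :- w) :* k :- :1)) refl w w⁻¹ k u v)
      (proj₂ (inverse w w≢0)) (proj₂ (inverse (1# - w) 1-w≢0))) ⟩
    θ (w * (z - e) + e)                     ≡⟨ affine z ⟩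
    w * θ z + (1# - w) * θ e                ≡⟨ cong₂ _+_ w-part 1-w-part ⟩
    θ u + θ v                               ∎
    where
    w⁻¹ = proj₁ (inverse w w≢0)
    1-w≢0 : 1# - w ≢ 0#
    1-w≢0 eq = w≢1 (sym (x-y≡0⇒x≡y eq))
    k = proj₁ (inverse (1# - w) 1-w≢0)
    z = w⁻¹ * u
    e = k * v
    affine : ∀ z → θ (w * (z - e) + e) ≡ w * θ z + (1# - w) * θ e
    affine z = linear-combination 1#
      (solve 4 (λ t w s r → t :- (w :* s :+ (:1 :- w) :* r) := :1 :* ((t :- r) :- w :* (s :- r)))
          refl _ w (θ z) (θ e))
      (trans (eqv (translate θ e) (translate-orthomorphism e orth) (translate-0 θ e) (z - e))
             (cong (λ x → w * (θ x - θ e)) (solve 2 (λ z e → z :- e :+ e := z) refl z e)))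
    w-part : w * θ z ≡ θ u
    w-part = begin
      w * θ z         ≡⟨ eqv θ orth θ0≡0 z ⟨
      θ (w * z)       ≡⟨ cong θ (linear-combination u
          (solve 3 (λ w w⁻¹ u → w :* (w⁻¹ :* u) :- u := u :* (w :* w⁻¹ :- :1)) refl w w⁻¹ u)
          (proj₂ (inverse w w≢0))) ⟩
      θ u             ∎
    -- At z = 0 the affine identity loses its first term and shows that `θ` commutes with 1 - w at
    -- `e`.
    1-w-part : (1# - w) * θ e ≡ θ v
    1-w-part = begin
      (1# - w) * θ e                  ≡⟨ trans (cong (_+ (1# - w) * θ e) (trans
          (cong (w *_) θ0≡0) (zeroʳ w))) (+-identityˡ _) ⟨
      w * θ 0# + (1# - w) * θ e       ≡⟨ affine 0# ⟨
      θ (w * (0# - e) + e)            ≡⟨ cong θ (linear-combination v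
          (solve 3 (λ w k v → w :* (:0 :- k :* v) :+ k :* v :- v := v :* ((:1 :- w) :* k :- :1)) refl w k v)
          (proj₂ (inverse (1# - w) 1-w≢0))) ⟩
      θ v                             ∎

  -- Full index in characteristic 2.

  -- With `δ` the indicator of the complement of `K` and κ = 1 / (1 + α), the map is θ x = κ α (x +
  -- δ x), and θ x - x = κ (x + α δ x). Both are injective because `K` is stable under adding 1 and
  -- `α`. As 1 lies in `K`, θ (w 1) = w θ 1 would put `w` into `K`.
  characteristic-2-not-allEquivariant : 1# + 1# ≡ 0# → 4 ℕ.< q → ∀ {w} → w ≢ 1# → w ≢ 0# → ¬ AllEquivariant w
  characteristic-2-not-allEquivariant 1+1≡0 4<q {w} w≢1 w≢0 eqv =
    w∉K (case-w (w-in-K))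
    where
    -- Avoiding 0 and 1 makes `α` and 1 + α invertible; avoiding `w` and w + 1 keeps `w` apart from
    -- `α` and 1 + α. Four avoided values account for the bound on q.
    α-avoiding : ∃ λ α → ∀ i → lookup (0# ∷ 1# ∷ w ∷ w + 1# ∷ []) i ≢ α
    α-avoiding = missed-value (lookup (0# ∷ 1# ∷ w ∷ w + 1# ∷ [])) 4<q
    α = proj₁ α-avoiding
    α≢0 = proj₂ α-avoiding zero ∘ sym
    α≢1 = proj₂ α-avoiding (suc zero) ∘ sym
    -- An additive group that does not contain w: since θ is x ↦ κ * α * x exactly on K, it cannot commute with w.
    K : Pred (Fin q) 0ℓ
    K x = (x ≡ 0# ⊎ x ≡ 1#) ⊎ (x ≡ α ⊎ x ≡ 1# + α)
    K? : Decidable K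
    K? x = (x Fin.≟ 0# ⊎-dec x Fin.≟ 1#) ⊎-dec (x Fin.≟ α ⊎-dec x Fin.≟ 1# + α)
    K-1+ : ∀ {x} → K x → K (x + 1#)
    K-1+ (inj₁ (inj₁ refl)) = inj₁ (inj₂ (+-identityˡ 1#))
    K-1+ (inj₁ (inj₂ refl)) = inj₁ (inj₁ 1+1≡0)
    K-1+ (inj₂ (inj₁ refl)) = inj₂ (inj₂ (+-comm α 1#))
    K-1+ (inj₂ (inj₂ refl)) = inj₂ (inj₁ (linear-combination 1#
        (solve 1 (λ α → :1 :+ α :+ :1 :- α := :1 :* ((:1 :+ :1) :- :0)) refl α) 1+1≡0))
    K-α+ : ∀ {x} → K x → K (x + α)
    K-α+ (inj₁ (inj₁ refl)) = inj₂ (inj₁ (+-identityˡ α))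
    K-α+ (inj₁ (inj₂ refl)) = inj₂ (inj₂ refl)
    K-α+ (inj₂ (inj₁ refl)) = inj₁ (inj₁ (linear-combination α
        (solve 1 (λ α → α :+ α :- :0 := α :* ((:1 :+ :1) :- :0)) refl α) 1+1≡0))
    K-α+ (inj₂ (inj₂ refl)) = inj₁ (inj₂ (linear-combination α
        (solve 1 (λ α → :1 :+ α :+ α :- :1 := α :* ((:1 :+ :1) :- :0)) refl α) 1+1≡0))
    δ : Fin q → Fin q
    δ x with K? x
    ... | yes _ = 0#
    ... | no  _ = 1#
    1+α≢0 : 1# + α ≢ 0#
    1+α≢0 eq = α≢1 (linear-combination₂ 1# (- 1#)
        (solve 1 (λ α → α :- :1 := :1 :* (:1 :+ α :- :0) :+ (:- :1) :* (:1 :+ :1 :- :0)) refl α) eq 1+1≡0)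
    κ = proj₁ (inverse (1# + α) 1+α≢0)
    κ-spec = proj₂ (inverse (1# + α) 1+α≢0)
    κ≢0 : κ ≢ 0#
    κ≢0 eq = 0≢1 (trans (sym (trans (cong ((1# + α) *_) eq) (zeroʳ _))) κ-spec)
    θ : Fin q → Fin q
    θ x = κ * (α * (x + δ x))
    -- In characteristic 2, κ α - 1 = κ, because κ (1 + α) = 1.
    θ-id : ∀ x → θ x - x ≡ κ * (x + α * δ x)
    θ-id x = linear-combination₂ x (- κ * x) (solve 4 (λ κ α x d → (κ :* (α :* (x :+ d)) :- x) :- κ :* (x :+ α :* d)
        := x :* ((:1 :+ α) :* κ :- :1) :+ (:- κ) :* x :* (:1 :+ :1 :- :0)) refl κ α x (δ x)) κ-spec 1+1≡0
    +δ-injective : Injective _≡_ _≡_ (λ x → x + δ x)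
    +δ-injective {x} {y} eq with K? x | K? y
    ... | yes _ | yes _ = linear-combination 1#
        (solve 2 (λ x y → x :- y := :1 :* ((x :+ :0) :- (y :+ :0))) refl x y) eq
    ... | no _  | no _  = linear-combination 1#
        (solve 2 (λ x y → x :- y := :1 :* ((x :+ :1) :- (y :+ :1))) refl x y) eq
    ... | yes p | no ¬p = contradiction (subst K (linear-combination₂ 1# 1#
        (solve 2 (λ x y → (x :+ :1) :- y := :1 :* ((x :+ :0) :- (y :+ :1)) :+ :1 :* (:1 :+ :1 :- :0))
        refl x y) eq 1+1≡0) (K-1+ p)) ¬p
    ... | no ¬p | yes p = contradiction (subst K (linear-combination₂ 1# 1#
        (solve 2 (λ x y → (y :+ :1) :- x := :1 :* ((y :+ :0) :- (x :+ :1)) :+ :1 :* (:1 :+ :1 :- :0)) refl x y)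
        (sym eq) 1+1≡0) (K-1+ p)) ¬p
    +αδ-injective : Injective _≡_ _≡_ (λ x → x + α * δ x)
    +αδ-injective {x} {y} eq with K? x | K? y
    ... | yes _ | yes _ = linear-combination 1#
        (solve 3 (λ x y α → x :- y := :1 :* ((x :+ α :* :0) :- (y :+ α :* :0))) refl x y α) eq
    ... | no _  | no _  = linear-combination 1#
        (solve 3 (λ x y α → x :- y := :1 :* ((x :+ α :* :1) :- (y :+ α :* :1))) refl x y α) eq
    ... | yes p | no ¬p = contradiction (subst K (linear-combination₂ 1# α
        (solve 3 (λ x y α → (x :+ α) :- y := :1 :* ((x :+ α :* :0) :- (y :+ α :* :1)) :+ α :* (:1 :+ :1 :- :0))
        refl x y α) eq 1+1≡0) (K-α+ p)) ¬p
    ... | no ¬p | yes p = contradiction (subst K (linear-combination₂ 1# α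
        (solve 3 (λ x y α → (y :+ α) :- x := :1 :* ((y :+ α :* :0) :- (x :+ α :* :1)) :+ α :* (:1 :+ :1 :- :0))
        refl x y α) (sym eq) 1+1≡0) (K-α+ p)) ¬p
    θ-orthomorphism : IsOrthomorphism θ
    θ-orthomorphism = orthomorphism
      (λ eq → +δ-injective (*-cancelˡ α≢0 (*-cancelˡ κ≢0 eq)))
      (λ {x} {y} eq → +αδ-injective (*-cancelˡ κ≢0 (trans (sym (θ-id x)) (trans eq (θ-id y)))))
    δ-K : ∀ {x} → K x → δ x ≡ 0#
    δ-K {x} p with K? x
    ... | yes _ = refl
    ... | no ¬p = contradiction p ¬p
    δ≡0⇒K : ∀ {x} → δ x ≡ 0# → K x
    δ≡0⇒K {x} eq with K? x
    ... | yes p = p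
    ... | no _  = contradiction (sym eq) 0≢1
    θ0≡0 : θ 0# ≡ 0#
    θ0≡0 = trans (cong (λ d → κ * (α * (0# + d))) (δ-K (inj₁ (inj₁ refl))))
        (solve 2 (λ κ α → κ :* (α :* (:0 :+ :0)) := :0) refl κ α)
    w-in-K : K w
    w-in-K = δ≡0⇒K (linear-combination 1#
      (solve 2 (λ w d → d :- :0 := :1 :* ((w :+ d) :- w)) refl w (δ w))
      (*-cancelˡ α≢0 (*-cancelˡ κ≢0 (begin
        κ * (α * (w + δ w))           ≡⟨ cong θ (*-identityʳ w) ⟨
        θ (w * 1#)                    ≡⟨ eqv θ θ-orthomorphism θ0≡0 1# ⟩
        w * (κ * (α * (1# + δ 1#)))   ≡⟨ cong (λ d → w * (κ * (α * (1# + d)))) (δ-K (inj₁ (inj₂ refl))) ⟩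
        w * (κ * (α * (1# + 0#)))     ≡⟨ solve 3 (λ w κ α → w :* (κ :* (α :* (:1 :+ :0))) := κ :* (α :* w))
            refl w κ α ⟩
        κ * (α * w)                   ∎))))
    case-w : K w → w ≡ α ⊎ w ≡ 1# + α
    case-w (inj₁ (inj₁ w≡0)) = contradiction w≡0 w≢0
    case-w (inj₁ (inj₂ w≡1)) = contradiction w≡1 w≢1
    case-w (inj₂ p) = p
    w∉K : ¬ (w ≡ α ⊎ w ≡ 1# + α)
    w∉K (inj₁ w≡α) = proj₂ α-avoiding (suc (suc zero)) w≡α
    w∉K (inj₂ w≡1+α) = proj₂ α-avoiding (suc (suc (suc zero)))
      (linear-combination₂ 1# 1# (solve 2 (λ w α → (w :+ :1) :- α := :1 :* (w :- (:1 :+ α)) :+ :1 :* (:1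
          :+ :1 :- :0)) refl w α) w≡1+α 1+1≡0)

-- The prime subfield and odd orthomorphisms.

module IntegralElements {n : ℕ} (F : FiniteField (suc n)) where

  open FiniteField F
  open FieldProperties F
  open ≡-Reasoning

  q : ℕ
  q = suc n

  -- Translation by 1 permutes the field, so the sum of all elements equals itself plus `ι q`.
  characteristic : ι q ≡ 0#
  characteristic = linear-combination (- 1#)
    (solve 2 (λ s c → c :- :0 := (:- :1) :* (s :- (s :+ c))) refl (sum id) (ι q)) (begin
    sum id                                       ≡⟨ sum-permute id shift ⟩
    sum (λ x → x + 1#)                                    ≡⟨ ∑-distrib-+ id (λ _ → 1#) ⟩
    sum id + sum {q} (λ _ → 1#)                  ≡⟨ cong (sum id +_) (sum-replicate q) ⟩
    sum id + ι q                                 ∎)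
    where
    open import Algebra.Properties.CommutativeMonoid.Sum +-commutativeMonoid
    shift : Permutation q q
    shift = permutation (_+ 1#) (_- 1#)
      (λ x → solve 1 (λ x → x :- :1 :+ :1 := x) refl x)
      (λ x → solve 1 (λ x → x :+ :1 :- :1 := x) refl x)

  ι-+ : ∀ i j → ι (i ℕ.+ j) ≡ ι i + ι j
  ι-+ = ×-homo-+ 1#

  ι-* : ∀ i j → ι (i ℕ.* j) ≡ ι i * ι j
  ι-* = ×1-homo-*

  ι-% : ∀ i → ι (i % q) ≡ ι i
  ι-% i = sym (begin
    ι i                                 ≡⟨ cong ι (m≡m%n+[m/n]*n i q) ⟩
    ι (i % q ℕ.+ i / q ℕ.* q)           ≡⟨ ι-+ (i % q) (i / q ℕ.* q) ⟩
    ι (i % q) + ι (i / q ℕ.* q)         ≡⟨ cong (ι (i % q) +_) (trans (ι-* (i / q) q) (trans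
        (cong (ι (i / q) *_) characteristic) (zeroʳ _))) ⟩
    ι (i % q) + 0#                      ≡⟨ +-identityʳ _ ⟩
    ι (i % q)                           ∎)

  -- Oddness is equivariance under -1, which is g ^ b when q - 1 = 2 b. This is the counterpart of
  -- `AllEquivariant` for that index.
  OddAllEquivariant : Fin q → Set
  OddAllEquivariant w = ∀ θ → IsOrthomorphism θ → θ 0# ≡ 0# → (∀ x → θ (- x) ≡ - θ x) → Equivariant w θ

  -- Halving the permutation x ↦ x + δ x gives an odd orthomorphism.
  deviation-equivariant : 1# + 1# ≢ 0# → ∀ {w} → OddAllEquivariant w → ∀ δ → (∀ x → δ (- x) ≡ - δ x) →
    Injective _≡_ _≡_ (λ x → x + δ x) → Injective _≡_ _≡_ (λ x → x - δ x) → Equivariant w δ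
  deviation-equivariant 2≢0 {w} eqv δ δ-odd plus-inj minus-inj x = linear-combination₂ (1# + 1#) (- (δ (w * x) + w * x - w * (δ x + x)))
    (solve 5 (λ η w x d e → d :- w :* e := (:1 :+ :1) :* (η :* (w :* x :+ d) :- w :* (η :* (x :+ e)))
      :+ (:- (d :+ w :* x :- w :* (e :+ x))) :* ((:1 :+ :1) :* η :- :1)) refl η w x (δ (w * x)) (δ x))
    (eqv θ θ-orthomorphism θ0≡0 θ-odd x) η-spec
    where
    η = proj₁ (inverse (1# + 1#) 2≢0)
    η-spec = proj₂ (inverse (1# + 1#) 2≢0)
    η≢0 : η ≢ 0#
    η≢0 eq = 0≢1 (trans (sym (trans (cong ((1# + 1#) *_) eq) (zeroʳ _))) η-spec)
    -η≢0 : - η ≢ 0#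
    -η≢0 eq = η≢0 (trans (sym (-‿involutive η)) (trans (cong -_ eq) -0#≈0#))
    θ : Fin q → Fin q
    θ x = η * (x + δ x)
    θ-odd : ∀ x → θ (- x) ≡ - θ x
    θ-odd x = trans (cong (λ d → η * (- x + d)) (δ-odd x))
        (solve 3 (λ η x d → η :* (:- x :+ :- d) := :- (η :* (x :+ d))) refl η x (δ x))
    θ0≡0 : θ 0# ≡ 0#
    θ0≡0 = *-cancelˡ 2≢0 (linear-combination 1#
        (solve 1 (λ t → (:1 :+ :1) :* t :- (:1 :+ :1) :* :0 := :1 :* (t :- :- t)) refl (θ 0#)) (trans (cong θ
        (sym -0#≈0#)) (θ-odd 0#)))
    θ-id : ∀ x → θ x - x ≡ - η * (x - δ x)
    θ-id x = linear-combination x (solve 3 (λ η x d → (η :* (x :+ d) :- x) :- (:- η) :* (x :- d) := x :* ((:1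
        :+ :1) :* η :- :1)) refl η x (δ x)) η-spec
    θ-orthomorphism : IsOrthomorphism θ
    θ-orthomorphism = orthomorphism (λ eq → plus-inj (*-cancelˡ η≢0 eq))
      (λ {x} {y} eq → minus-inj (*-cancelˡ -η≢0 (trans (sym (θ-id x)) (trans eq (θ-id y)))))

  -- The prime subfield, as the image of ℕ; reduction modulo q makes membership a finite search.
  Integral : Pred (Fin q) 0ℓ
  Integral x = ∃ λ i → ι i ≡ x

  Integral-Fin : ∀ {x} → Integral x → ∃ λ (i : Fin q) → ι (toℕ i) ≡ x
  Integral-Fin (i , refl) = i mod q , trans (cong ι (Fin.toℕ-fromℕ< (m%n<n i q))) (ι-% i)

  Integral? : Decidable Integral
  Integral? x = map′ (λ (i , eq) → toℕ i , eq) Integral-Fin (Fin.any? (λ i → ι (toℕ i) Fin.≟ x))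

  integral-+ : ∀ {x y} → Integral x → Integral y → Integral (x + y)
  integral-+ (i , refl) (j , refl) = i ℕ.+ j , ι-+ i j

  integral-* : ∀ {x y} → Integral x → Integral y → Integral (x * y)
  integral-* (i , refl) (j , refl) = i ℕ.* j , ι-* i j

  integral-0 : Integral 0#
  integral-0 = 0 , refl

  integral-1 : Integral 1#
  integral-1 = 1 , +-identityʳ 1#

  -- `ι n` is -1, since 1 + n is the order of the field.
  integral-neg : ∀ {x} → Integral x → Integral (- x)
  integral-neg {x} p = subst Integral (linear-combination x
    (solve 2 (λ x m → m :* x :- :- x := x :* (:1 :+ m :- :0)) refl x (ι n)) characteristic) (integral-* (n , refl) p)

  -- Index (q - 1) / 2 over a proper prime subfield.

  module HalfOrder {b : ℕ} (n≡b+b : n ≡ b ℕ.+ b) (2≢0 : 1# + 1# ≢ 0#) where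

    1+2b≡0 : 1# + (ι b + ι b) ≡ 0#
    1+2b≡0 = trans (cong (1# +_) (sym (trans (cong ι n≡b+b) (ι-+ b b)))) characteristic

    -- 1 + 2 b = 0 makes - `ι b` the inverse of 2.
    integral-half : ∀ {x} → Integral (x + x) → Integral x
    integral-half {x} p = subst Integral (linear-combination (- x)
      (solve 2 (λ x m → :- (m :* (x :+ x)) :- x := (:- x) :* (:1 :+ (m :+ m) :- :0))
          refl x (ι b)) 1+2b≡0) (integral-neg (integral-* (b , refl) p))

    -- The cosets of `u` and - `u` modulo the prime subfield are disjoint, as otherwise 2 u and then
    -- `u` would be integral. With `δ` equal to 1 and -1 on them and 0 elsewhere, commuting with `w`
    -- would give δ (w u) = w, but `w` is none of 1, -1 and 0.
    nonintegral-not-equivariant : ∀ {u} → ¬ Integral u → ∀ {w} → w ≢ 0# → w ≢ 1# → w ≢ - 1# → ¬ OddAllEquivariant w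
    nonintegral-not-equivariant {u} u∉K {w} w≢0 w≢1 w≢-1 eqv = values (w * u)
      (trans (deviation-equivariant 2≢0 eqv δ δ-odd plus-injective minus-injective u) (trans
          (cong (w *_) δ-u) (*-identityʳ w)))
      where
      δ : Fin q → Fin q
      δ x with Integral? (x - u) | Integral? (x + u)
      ... | yes _ | _     = 1#
      ... | no _  | yes _ = - 1#
      ... | no _  | no _  = 0#
      δ-u : δ u ≡ 1#
      δ-u with Integral? (u - u)
      ... | yes _ = refl
      ... | no ¬p = contradiction (0 , sym (-‿inverseʳ u)) ¬p
      values : ∀ x → δ x ≡ w → ⊥
      values x with Integral? (x - u) | Integral? (x + u)
      ... | yes _ | _     = w≢1 ∘ sym
      ... | no _  | yes _ = w≢-1 ∘ sym
      ... | no _  | no _  = w≢0 ∘ sym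
      exclusive : ∀ {x} → Integral (x - u) → Integral (x + u) → ⊥
      exclusive {x} p p′ = u∉K (integral-half (subst Integral
        (solve 2 (λ x u → (x :+ u) :+ :- (x :- u) := u :+ u) refl x u) (integral-+ p′ (integral-neg p))))
      negate : ∀ {x y} → - x ≡ y → Integral x → Integral y
      negate refl = integral-neg
      δ-odd : ∀ x → δ (- x) ≡ - δ x
      δ-odd x with Integral? (x - u) | Integral? (x + u) | Integral? (- x - u) | Integral? (- x + u)
      ... | yes p | yes p′ | _ | _ = contradiction p′ (exclusive p)
      ... | _ | _ | yes r | yes r′ = contradiction r′ (exclusive r)
      ... | yes p | no _ | no _ | yes _ = refl
      ... | no _ | yes _ | yes _ | no _ = sym (-‿involutive 1#)
      ... | no _ | no _ | no _ | no _ = sym -0#≈0#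
      ... | yes p | _ | _ | no ¬r′ = contradiction (negate
          (solve 2 (λ x u → :- (x :- u) := :- x :+ u) refl x u) p) ¬r′
      ... | no ¬p | _ | _ | yes r′ = contradiction (negate
          (solve 2 (λ x u → :- (:- x :+ u) := x :- u) refl x u) r′) ¬p
      ... | _ | yes p′ | no ¬r | _ = contradiction (negate
          (solve 2 (λ x u → :- (x :+ u) := :- x :- u) refl x u) p′) ¬r
      ... | _ | no ¬p′ | yes r | _ = contradiction (negate
          (solve 2 (λ x u → :- (:- x :- u) := x :+ u) refl x u) r) ¬p′
      shift : ∀ {x y k} → Integral k → x + k ≡ y → Integral x → Integral y
      shift k refl p = integral-+ p k
      δ-periodic : ∀ x k → Integral k → δ (x + k) ≡ δ x
      δ-periodic x k p with Integral? (x - u) | Integral? (x + u) | Integral? (x + k - u) | Integral? (x + k + u)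
      ... | yes _ | _ | yes _ | _ = refl
      ... | no _ | yes _ | no _ | yes _ = refl
      ... | no _ | no _ | no _ | no _ = refl
      ... | yes r | _ | no ¬r′ | _ = contradiction (shift p
          (solve 3 (λ x k u → x :- u :+ k := x :+ k :- u) refl x k u) r) ¬r′
      ... | no ¬r | _ | yes r′ | _ = contradiction (shift (integral-neg p)
          (solve 3 (λ x k u → x :+ k :- u :+ :- k := x :- u) refl x k u) r′) ¬r
      ... | _ | yes s | _ | no ¬s′ = contradiction (shift p
          (solve 3 (λ x k u → x :+ u :+ k := x :+ k :+ u) refl x k u) s) ¬s′
      ... | _ | no ¬s | _ | yes s′ = contradiction (shift (integral-neg p)
          (solve 3 (λ x k u → x :+ k :+ u :+ :- k := x :+ u) refl x k u) s′) ¬s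
      δ-integral : ∀ x → Integral (δ x)
      δ-integral x with Integral? (x - u) | Integral? (x + u)
      ... | yes _ | _     = integral-1
      ... | no _  | yes _ = integral-neg integral-1
      ... | no _  | no _  = integral-0
      -- `δ` is constant on the cosets of the prime subfield and takes values in it, so δ (x + δ x)
      -- = δ x and the image determines the shift.
      plus-injective : Injective _≡_ _≡_ (λ x → x + δ x)
      plus-injective {x} {y} eq = linear-combination₂ 1# (- 1#)
          (solve 4 (λ x y d e → x :- y := :1 :* ((x :+ d) :- (y :+ e)) :+ (:- :1) :* (d :- e))
          refl x y (δ x) (δ y)) eq
        (trans (sym (δ-periodic x (δ x) (δ-integral x))) (trans (cong δ eq) (δ-periodic y (δ y) (δ-integral y))))
      minus-injective : Injective _≡_ _≡_ (λ x → x - δ x)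
      minus-injective {x} {y} eq = linear-combination₂ 1# 1#
          (solve 4 (λ x y d e → x :- y := :1 :* ((x :- d) :- (y :- e)) :+ :1 :* (d :- e)) refl x y (δ x) (δ y)) eq
        (trans (sym (δ-periodic x (- δ x) (integral-neg (δ-integral x)))) (trans
            (cong δ eq) (δ-periodic y (- δ y) (integral-neg (δ-integral y)))))

-- Index (q - 1) / 2 when the field is its own prime subfield.

module Interval {n : ℕ} (F : FiniteField (suc n)) {b : ℕ} (n≡b+b : n ≡ b ℕ.+ b)
                (2≢0 : FiniteField._+_ F (FiniteField.1# F) (FiniteField.1# F) ≢ FiniteField.0# F)
                (4≤b : 4 ℕ.≤ b) (index : Fin (suc n) → ℕ) (index<q : ∀ x → index x ℕ.< suc n)
                (ι-index : ∀ x → FieldProperties.ι F (index x) ≡ x) where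

  open FiniteField F
  open FieldProperties F
  open IntegralElements F
  open ≡-Reasoning

  -- `index` shows that `ι` is surjective on the residues below `q`, hence injective by finiteness.
  ι-injective : ∀ {i j} → i ℕ.< q → j ℕ.< q → ι i ≡ ι j → i ≡ j
  ι-injective {i} {j} i<q j<q eq = Fin.fromℕ<-injective _ _ i<q j<q
    (surjective⇒injective {f = ι ∘ toℕ} (λ x → fromℕ< (index<q x) , trans
        (cong ι (Fin.toℕ-fromℕ< (index<q x))) (ι-index x))
      (trans (cong ι (Fin.toℕ-fromℕ< i<q)) (trans eq (cong ι (sym (Fin.toℕ-fromℕ< j<q))))))

  index-ι : ∀ {i} → i ℕ.< q → index (ι i) ≡ i
  index-ι {i} i<q = ι-injective (index<q (ι i)) i<q (ι-index (ι i))

  8≤n : 8 ℕ.≤ n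
  8≤n = subst (8 ℕ.≤_) (sym n≡b+b) (ℕ.+-mono-≤ 4≤b 4≤b)

  ι≡0⇒≡0 : ∀ {i} → i ℕ.< q → ι i ≡ 0# → i ≡ 0
  ι≡0⇒≡0 i<q = ι-injective i<q ℕ.z<s

  three≢0 : ι 3 ≢ 0#
  three≢0 eq with ι≡0⇒≡0 {3} (s≤s (ℕ.≤-trans (ℕ.m≤m+n 3 5) 8≤n)) eq
  ... | ()

  data Remainder : ℕ → Set where
    r1 : Remainder 1
    r2 : Remainder 2

  -- Were q = 3 s, the field would satisfy s * 3 = 0, whereas `s` and 3 lie strictly between 0 and
  -- `q` and so have non-zero images.
  3∤q : ∀ s → q ≢ s ℕ.* 3
  3∤q s@(suc _) q≡ = [ s≢0 , three≢0 ]′ (zero-product product≡0)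
    where
    product≡0 : ι s * ι 3 ≡ 0#
    product≡0 = begin
      ι s * ι 3       ≡⟨ ι-* s 3 ⟨
      ι (s ℕ.* 3)     ≡⟨ cong ι q≡ ⟨
      ι q             ≡⟨ characteristic ⟩
      0#              ∎
    s<q : s ℕ.< q
    s<q = subst (s ℕ.<_) (sym q≡) (ℕ.m<m*n s 3 (s≤s (s≤s z≤n)))
    s≢0 : ι s ≢ 0#
    s≢0 eq = contradiction (ι≡0⇒≡0 {s} s<q eq) λ ()

  remainder : ∀ {r s} → r ℕ.< 3 → q ≡ r ℕ.+ s ℕ.* 3 → Remainder r
  remainder {0} {s} _ q≡ = contradiction q≡ (3∤q s)
  remainder {1} _ _ = r1
  remainder {2} _ _ = r2
  remainder {suc (suc (suc _))} (s≤s (s≤s (s≤s ()))) _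

  module WithThird {t r : ℕ} (rem : Remainder r) (q≡ : q ≡ r ℕ.+ t ℕ.* 3) where

    3≤t : 3 ℕ.≤ t
    -- Otherwise q ≤ 2 + 2 * 3 = 8, while `8≤n` gives q ≥ 9.
    3≤t = ℕ.≮⇒≥ λ t<3 → ℕ.<⇒≱ (ℕ.≤-<-trans (ℕ.+-mono-≤ (r≤2 rem) (ℕ.*-monoˡ-≤ 3 (ℕ.≤-pred t<3))) (ℕ.n<1+n 8))
                          (subst (9 ℕ.≤_) q≡ (s≤s 8≤n))
      where
      r≤2 : ∀ {r} → Remainder r → r ℕ.≤ 2
      r≤2 r1 = s≤s z≤n
      r≤2 r2 = s≤s (s≤s z≤n)

    -- Gives t + 1 ≤ b, so the whole support of `δℕ` lies in [1, b].
    t<b : t ℕ.< b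
    t<b = third<half (ℕ.≤-trans (s≤s z≤n) 3≤t) (0<r rem) (trans (cong suc (sym n≡b+b)) q≡)
      where
      0<r : ∀ {r} → Remainder r → 0 ℕ.< r
      0<r r1 = ℕ.z<s
      0<r r2 = ℕ.z<s

    b<q : b ℕ.< q
    b<q = subst (b ℕ.<_) (cong suc (sym n≡b+b)) (s≤s (ℕ.m≤m+n b b))

    T : Fin q
    T = ι t

    r+3t≡0 : ι r + (T + T + T) ≡ 0#
    r+3t≡0 = begin
      ι r + (T + T + T)       ≡⟨ cong (ι r +_)
          (solve 1 (λ T → T :+ T :+ T := T :* (:1 :+ (:1 :+ (:1 :+ :0)))) refl T) ⟩
      ι r + T * ι 3           ≡⟨ cong (ι r +_) (ι-* t 3) ⟨
      ι r + ι (t ℕ.* 3)       ≡⟨ ι-+ r (t ℕ.* 3) ⟨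
      ι (r ℕ.+ t ℕ.* 3)       ≡⟨ cong ι q≡ ⟨
      ι q                     ≡⟨ characteristic ⟩
      0#                      ∎

    -- On the interval [2, t) the maps x ↦ x ± δ x are the shifts by ± 1. At t and 1 + t they are 3 x and - x; as
    -- 3 t ≡ - r with r = 1 or 2, the values 3 t and 3 (1 + t) are, up to sign, 1 and 2, which the shift leaves free.
    δℕ : ℕ → Fin q
    δℕ 0 = 0#
    δℕ 1 = T
    δℕ m@(suc (suc _)) with m ℕ.<? t | m ℕ.≤? suc t
    ... | yes _ | _     = 1#
    ... | no _  | yes _ = ι m + ι m
    ... | no _  | no _  = 0#

    -- `t` and t + 1 get separate constructors because `φ` reaches them from different places, t - 1
    -- and 1.
    data Zone : ℕ → Set where
      zero  : Zone 0
      one   : Zone 1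
      lower : ∀ {m} → 2 ℕ.≤ m → m ℕ.< t → Zone m
      peak  : Zone t
      peak+ : Zone (suc t)
      upper : ∀ {m} → suc t ℕ.< m → Zone m

    zone : ∀ m → Zone m
    zone 0 = zero
    zone 1 = one
    zone m@(suc (suc _)) with ℕ.<-cmp m t | ℕ.<-cmp m (suc t)
    ... | tri< m<t _ _ | _ = lower (s≤s (s≤s z≤n)) m<t
    ... | tri≈ _ m≡t _ | _ = subst Zone (sym m≡t) peak
    ... | tri> _ _ t<m | tri< m<1+t _ _ = contradiction m<1+t (ℕ.≤⇒≯ t<m)
    ... | tri> _ _ t<m | tri≈ _ m≡1+t _ = subst Zone (sym m≡1+t) peak+
    ... | tri> _ _ t<m | tri> _ _ 1+t<m = upper 1+t<m

    δℕ-lower : ∀ {m} → 2 ℕ.≤ m → m ℕ.< t → δℕ m ≡ 1#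
    δℕ-lower {1} (s≤s ()) _
    δℕ-lower {m@(suc (suc _))} _ m<t with m ℕ.<? t
    ... | yes _  = refl
    ... | no m≮t = contradiction m<t m≮t

    δℕ-peak : ∀ {m} → t ℕ.≤ m → m ℕ.≤ suc t → δℕ m ≡ ι m + ι m
    δℕ-peak {0} t≤m _ = contradiction (ℕ.≤-trans 3≤t t≤m) λ ()
    δℕ-peak {1} t≤m _ = contradiction (ℕ.≤-trans 3≤t t≤m) λ { (s≤s ()) }
    δℕ-peak {m@(suc (suc _))} t≤m m≤1+t with m ℕ.<? t | m ℕ.≤? suc t
    ... | yes m<t | _      = contradiction t≤m (ℕ.<⇒≱ m<t)
    ... | no _ | yes _     = refl
    ... | no _ | no m≰1+t  = contradiction m≤1+t m≰1+t

    δℕ-upper : ∀ {m} → suc t ℕ.< m → δℕ m ≡ 0#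
    δℕ-upper {1} (s≤s ())
    δℕ-upper {m@(suc (suc _))} 1+t<m with m ℕ.<? t | m ℕ.≤? suc t
    ... | yes m<t | _      = contradiction m<t (ℕ.<⇒≯ (ℕ.m+n≤o⇒n≤o 1 1+t<m))
    ... | no _ | yes m≤1+t = contradiction m≤1+t (ℕ.<⇒≱ 1+t<m)
    ... | no _ | no _      = refl

    -- The odd extension of `δℕ` from [0, b]: an index i above `b` represents the negative of q - i,
    -- which lies in [1, b].
    δ : Fin q → Fin q
    δ x with index x ℕ.≤? b
    ... | yes _ = δℕ (index x)
    ... | no  _ = - δℕ (q ∸ index x)

    δ-pos : ∀ {m} → m ℕ.≤ b → δ (ι m) ≡ δℕ m
    δ-pos {m} m≤b with index (ι m) ℕ.≤? b
    ... | yes _  = cong δℕ (index-ι (ℕ.≤-<-trans m≤b b<q))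
    ... | no i≰b = contradiction (subst (ℕ._≤ b) (sym (index-ι (ℕ.≤-<-trans m≤b b<q))) m≤b) i≰b

    ι-∸ : ∀ {m} → m ℕ.≤ q → ι (q ∸ m) ≡ - ι m
    ι-∸ {m} m≤q = linear-combination 1#
      (solve 2 (λ x y → y :- :- x := :1 :* ((x :+ y) :- :0)) refl (ι m) (ι (q ∸ m)))
      (trans (sym (ι-+ m (q ∸ m))) (trans (cong ι (ℕ.m+[n∸m]≡n m≤q)) characteristic))

    b<q∸ : ∀ {m} → m ℕ.≤ b → b ℕ.< q ∸ m
    b<q∸ {m} m≤b = ℕ.≤-trans (ℕ.≤-reflexive (sym (trans (cong (λ k → suc k ∸ b) n≡b+b) (ℕ.m+n∸n≡m (suc b) b))))
        (ℕ.∸-monoʳ-≤ q m≤b)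

    index-neg : ∀ {m} → suc m ℕ.≤ b → index (- ι (suc m)) ≡ q ∸ suc m
    index-neg {m} 1+m≤b = trans (cong index (sym (ι-∸ 1+m≤q))) (index-ι (ℕ.∸-monoʳ-< ℕ.z<s 1+m≤q))
      where
      1+m≤q : suc m ℕ.≤ q
      1+m≤q = ℕ.≤-trans 1+m≤b (ℕ.<⇒≤ b<q)

    δ-neg : ∀ {m} → m ℕ.≤ b → δ (- ι m) ≡ - δℕ m
    δ-neg {0} _ = trans (cong δ -0#≈0#) (trans (δ-pos z≤n) (sym -0#≈0#))
    δ-neg {m@(suc _)} m≤b with index (- ι m) ℕ.≤? b
    ... | yes i≤b = contradiction (b<q∸ m≤b) (ℕ.≤⇒≯ (subst (ℕ._≤ b) (index-neg m≤b) i≤b))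
    ... | no _    = cong (λ k → - δℕ k) (trans (cong (q ∸_) (index-neg m≤b)) (ℕ.m∸[m∸n]≡n (ℕ.≤-trans m≤b
        (ℕ.<⇒≤ b<q))))

    -- Representatives of least absolute value; oddness then reduces claims about the field to
    -- [0, b].
    signed : ∀ x → ∃ λ m → m ℕ.≤ b × (x ≡ ι m ⊎ x ≡ - ι m)
    signed x with index x ℕ.≤? b
    ... | yes i≤b = index x , i≤b , inj₁ (sym (ι-index x))
    ... | no  i≰b = q ∸ index x , q∸i≤b , inj₂ (begin
      x                         ≡⟨ -‿involutive x ⟨
      - (- x)                   ≡⟨ cong (λ y → - (- y)) (ι-index x) ⟨
      - (- ι (index x))         ≡⟨ cong -_ (ι-∸ (ℕ.<⇒≤ (index<q x))) ⟨
      - ι (q ∸ index x)         ∎)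
      where
      q∸i≤b : q ∸ index x ℕ.≤ b
      q∸i≤b = ℕ.≤-trans (ℕ.∸-monoʳ-≤ q (ℕ.≰⇒> i≰b)) (ℕ.≤-reflexive (trans (cong (_∸ b) n≡b+b) (ℕ.m+n∸n≡m b b)))

    δ-odd : ∀ x → δ (- x) ≡ - δ x
    δ-odd x with signed x
    ... | m , m≤b , inj₁ refl = trans (δ-neg m≤b) (cong -_ (sym (δ-pos m≤b)))
    ... | m , m≤b , inj₂ refl = trans (trans (cong δ (-‿involutive (ι m))) (δ-pos m≤b)) (trans
        (sym (-‿involutive _)) (cong -_ (sym (δ-neg m≤b))))

    -- By oddness only the representatives in [0, b] have to be hit. Surjectivity is what explicit
    -- preimages establish, and finiteness turns it into injectivity.
    odd-surjective : ∀ {f} → (∀ x → f (- x) ≡ - f x) → (∀ {m} → Zone m → m ℕ.≤ b → ∃ λ x → f x ≡ ι m) →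
                     StrictlySurjective _≡_ f
    odd-surjective f-odd hit y with signed y
    ... | m , m≤b , inj₁ refl = hit (zone m) m≤b
    ... | m , m≤b , inj₂ refl with x , eq ← hit (zone m) m≤b = - x , trans (f-odd x) (cong -_ eq)

    t≤b : t ℕ.≤ b
    t≤b = ℕ.<⇒≤ t<b

    1≤b : 1 ℕ.≤ b
    1≤b = ℕ.≤-trans (s≤s z≤n) 4≤b

    δ-T : δ T ≡ T + T
    δ-T = trans (δ-pos t≤b) (δℕ-peak ℕ.≤-refl (ℕ.n≤1+n t))

    δ-1+T : δ (ι (suc t)) ≡ ι (suc t) + ι (suc t)
    δ-1+T = trans (δ-pos t<b) (δℕ-peak (ℕ.n≤1+n t) ℕ.≤-refl)

    φ ψ : Fin q → Fin q
    φ x = x + δ x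
    ψ x = x - δ x

    φ-odd : ∀ x → φ (- x) ≡ - φ x
    φ-odd x = trans (cong (λ d → - x + d) (δ-odd x)) (solve 2 (λ x d → :- x :+ :- d := :- (x :+ d)) refl x (δ x))

    ψ-odd : ∀ x → ψ (- x) ≡ - ψ x
    ψ-odd x = trans (cong (λ d → - x - d) (δ-odd x)) (solve 2 (λ x d → :- x :- :- d := :- (x :- d)) refl x (δ x))

    -- The shifts cover [3, t] and the point 1 goes to t + 1, which leaves 1 and 2 open. They are
    -- filled thanks to 3 t = - r: φ (- T) = r and φ (T + 1) = 3 - r.
    φ-wraps : ∀ {r} → Remainder r → ι r + (T + T + T) ≡ 0# →
              (∃ λ x → φ x ≡ ι 1) × (∃ λ x → φ x ≡ ι 2)
    φ-wraps r1 eq = (- T , (begin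
        φ (- T)           ≡⟨ φ-odd T ⟩
        - φ T             ≡⟨ cong (λ d → - (T + d)) δ-T ⟩
        - (T + (T + T))   ≡⟨ linear-combination (- 1#)
            (solve 1 (λ T → :- (T :+ (T :+ T)) :- (:1 :+ :0) := (:- :1) :* ((:1 :+ :0) :+ (T :+ T :+ T) :- :0))
            refl T) eq ⟩
        ι 1               ∎))
      , (ι (suc t) , trans (cong (ι (suc t) +_) δ-1+T)
          (linear-combination 1# (solve 1 (λ T → (:1 :+ T) :+ ((:1 :+ T) :+ (:1 :+ T)) :- (:1 :+ (:1 :+ :0))
              := :1 :* ((:1 :+ :0) :+ (T :+ T :+ T) :- :0)) refl T) eq))
    φ-wraps r2 eq = (ι (suc t) , trans (cong (ι (suc t) +_) δ-1+T)
          (linear-combination 1# (solve 1 (λ T → (:1 :+ T) :+ ((:1 :+ T) :+ (:1 :+ T)) :- (:1 :+ :0) := :1 :* ((:1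
              :+ (:1 :+ :0)) :+ (T :+ T :+ T) :- :0)) refl T) eq))
      , (- T , (begin
        φ (- T)           ≡⟨ φ-odd T ⟩
        - φ T             ≡⟨ cong (λ d → - (T + d)) δ-T ⟩
        - (T + (T + T))   ≡⟨ linear-combination (- 1#)
            (solve 1 (λ T → :- (T :+ (T :+ T)) :- (:1 :+ (:1 :+ :0)) := (:- :1) :* ((:1 :+ (:1 :+ :0)) :+ (T :+ T
            :+ T) :- :0)) refl T) eq ⟩
        ι 2               ∎))

    φ-predecessor : ∀ {m} → 2 ℕ.≤ m → m ℕ.< t → φ (ι m) ≡ ι (suc m)
    φ-predecessor {m} 2≤m m<t = trans
      (cong (ι m +_) (trans (δ-pos (ℕ.≤-trans (ℕ.<⇒≤ m<t) t≤b)) (δℕ-lower 2≤m m<t)))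
      (+-comm (ι m) 1#)

    φ-hit : ∀ {m} → Zone m → m ℕ.≤ b → ∃ λ x → φ x ≡ ι m
    φ-hit zero _ = 0# , trans (cong (0# +_) (δ-pos z≤n)) (+-identityˡ 0#)
    φ-hit one  _ = proj₁ (φ-wraps rem r+3t≡0)
    φ-hit (lower {1} (s≤s ()) _) _
    φ-hit (lower {2} _ _) _ = proj₂ (φ-wraps rem r+3t≡0)
    φ-hit (lower {suc m@(suc (suc _))} _ m<t) _ = ι m , φ-predecessor (s≤s (s≤s z≤n)) (ℕ.<⇒≤ m<t)
    φ-hit peak _ = predecessor t 3≤t ℕ.≤-refl
      where
      -- `t` is generalised to `m`, so that it can be matched as a successor.
      predecessor : ∀ m → 3 ℕ.≤ m → m ℕ.≤ t → ∃ λ x → φ x ≡ ι m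
      predecessor (suc m) (s≤s 2≤m) m<t = ι m , φ-predecessor 2≤m m<t
    φ-hit peak+ _ = ι 1 , trans (cong (ι 1 +_) (δ-pos 1≤b)) (sym (ι-+ 1 t))
    φ-hit (upper {m} 1+t<m) m≤b = ι m , trans (cong (ι m +_) (trans (δ-pos m≤b) (δℕ-upper 1+t<m))) (+-identityʳ _)

    ψ-successor : ∀ {m} → 1 ℕ.≤ m → suc m ℕ.< t → ψ (ι (suc m)) ≡ ι m
    ψ-successor {m} 1≤m 1+m<t = trans
      (cong (λ d → ι (suc m) - d) (trans (δ-pos (ℕ.≤-trans (ℕ.<⇒≤ 1+m<t) t≤b)) (δℕ-lower (s≤s 1≤m) 1+m<t)))
      (solve 1 (λ m → :1 :+ m :- :1 := m) refl (ι m))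

    ψ-peak : ∀ {x} → δ x ≡ x + x → ψ (- x) ≡ x
    ψ-peak {x} eq = trans (ψ-odd x) (trans (cong (λ d → - (x - d)) eq)
        (solve 1 (λ x → :- (x :- (x :+ x)) := x) refl x))

    ψ-hit : ∀ {m} → Zone m → m ℕ.≤ b → ∃ λ x → ψ x ≡ ι m
    ψ-hit zero _ = 0# , trans (cong (λ d → 0# - d) (δ-pos z≤n)) (-‿inverseʳ 0#)
    ψ-hit one  _ = ι 2 , ψ-successor ℕ.≤-refl 3≤t
    ψ-hit (lower {m} 2≤m m<t) _ with suc m ℕ.<? t
    ... | yes 1+m<t = ι (suc m) , ψ-successor (ℕ.≤-trans (s≤s z≤n) 2≤m) 1+m<t
    -- Here m = t - 1, which the shift by -1 does not reach; it is the image of -1, as ψ 1 = 1 - t.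
    ... | no  1+m≮t = - ι 1 , (begin
      ψ (- ι 1)           ≡⟨ ψ-odd (ι 1) ⟩
      - (ι 1 - δ (ι 1))   ≡⟨ cong (λ d → - (ι 1 - d)) (δ-pos 1≤b) ⟩
      - (ι 1 - T)         ≡⟨ cong (λ k → - (ι 1 - ι k)) (ℕ.≤-antisym (ℕ.≮⇒≥ 1+m≮t) m<t) ⟩
      - (ι 1 - ι (suc m)) ≡⟨ solve 1 (λ m → :- ((:1 :+ :0) :- (:1 :+ m)) := m) refl (ι m) ⟩
      ι m                 ∎)
    ψ-hit peak  _ = - T , ψ-peak δ-T
    ψ-hit peak+ _ = - ι (suc t) , ψ-peak δ-1+T
    ψ-hit (upper {m} 1+t<m) m≤b = ι m , trans (cong (λ d → ι m - d) (trans (δ-pos m≤b) (δℕ-upper 1+t<m)))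
      (solve 1 (λ m → m :- :0 := m) refl (ι m))

    2<q : 2 ℕ.< q
    2<q = s≤s (ℕ.≤-trans (ℕ.m≤m+n 2 6) 8≤n)

    -- At `t` and t + 1 the deviation is 2 m, so that 2 (2 m) = m would mean 3 m = 0.
    δℕ-peak-ratio : ∀ {m} → t ℕ.≤ m → m ℕ.≤ suc t → m ℕ.≤ b → δℕ m * ι 2 ≢ ι m
    δℕ-peak-ratio {m} t≤m m≤1+t m≤b eq = [ three≢0 , m≢0 ]′ (zero-product {ι 3} {ι m} (linear-combination 1#
      (solve 1 (λ x → (:1 :+ (:1 :+ (:1 :+ :0))) :* x :- :0 := :1 :* ((x :+ x) :* (:1 :+ (:1 :+ :0)) :- x))
          refl (ι m))
      (trans (cong (_* ι 2) (sym (δℕ-peak t≤m m≤1+t))) eq)))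
      where
      m≢0 : ι m ≢ 0#
      m≢0 ιm≡0 with ι≡0⇒≡0 (ℕ.≤-<-trans m≤b b<q) ιm≡0 | ℕ.≤-trans 3≤t t≤m
      ... | refl | ()

    -- An odd δ commuting with w would give w * 2 the ratio δ x / x of 2, but only ± 2 have that ratio.
    δℕ-ratio : ∀ {m} → Zone m → m ℕ.≤ b → δℕ m ≢ 0# → δℕ m * ι 2 ≡ ι m → m ≡ 2
    δℕ-ratio zero _ nz _ = contradiction refl nz
    -- 2 t = 1 in the field lifts to ℕ because 2 t ≤ 2 b < q, and there it is impossible.
    δℕ-ratio one _ _ eq with ℕ.m*n≡1⇒n≡1 t 2 (ι-injective 2t<q (ℕ.≤-<-trans 1≤b b<q) (trans (ι-* t 2) eq))
      where
      2t<q : t ℕ.* 2 ℕ.< q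
      2t<q = subst (t ℕ.* 2 ℕ.<_) (cong suc (sym n≡b+b)) (s≤s (subst (ℕ._≤ b ℕ.+ b) (trans (cong (t ℕ.+_) (sym
          (ℕ.+-identityʳ t))) (ℕ.*-comm 2 t)) (ℕ.+-mono-≤ t≤b t≤b)))
    ... | ()
    δℕ-ratio (lower {m} 2≤m m<t) m≤b _ eq = sym (ι-injective 2<q (ℕ.≤-<-trans m≤b b<q)
      (trans (sym (*-identityˡ (ι 2))) (trans (cong (_* ι 2) (sym (δℕ-lower 2≤m m<t))) eq)))
    δℕ-ratio (upper 1+t<m) _ nz _ = contradiction (δℕ-upper 1+t<m) nz
    δℕ-ratio peak  m≤b _ eq = contradiction eq (δℕ-peak-ratio ℕ.≤-refl (ℕ.n≤1+n t) m≤b)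
    δℕ-ratio peak+ m≤b _ eq = contradiction eq (δℕ-peak-ratio (ℕ.n≤1+n t) ℕ.≤-refl m≤b)

    not-equivariant : ∀ {w} → w ≢ 0# → w ≢ 1# → w ≢ - 1# → ¬ OddAllEquivariant w
    not-equivariant {w} w≢0 w≢1 w≢-1 eqv = position (signed (w * ι 2))
      where
      -- 2 lies in [2, t), so δ 2 = 1 and commuting with `w` yields δ (2 w) = w. Then 2 w has the
      -- ratio 1 / 2 and must be 2 or -2.
      δ-2w : δ (w * ι 2) ≡ w
      δ-2w = trans
        (deviation-equivariant 2≢0 eqv δ δ-odd
          (surjective⇒injective (odd-surjective φ-odd φ-hit)) (surjective⇒injective (odd-surjective ψ-odd ψ-hit)) (ι 2))
        (trans (cong (w *_) (trans (δ-pos (ℕ.≤-trans (ℕ.m≤m+n 2 2) 4≤b)) (δℕ-lower ℕ.≤-refl 3≤t))) (*-identityʳ w))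
      two≢0 : ι 2 ≢ 0#
      two≢0 eq = contradiction (ι≡0⇒≡0 2<q eq) λ ()
      position : (∃ λ m → m ℕ.≤ b × (w * ι 2 ≡ ι m ⊎ w * ι 2 ≡ - ι m)) → ⊥
      position (m , m≤b , inj₁ eq) = w≢1 (*-cancelˡ two≢0 (trans (*-comm (ι 2) w) (trans eq (trans (cong ι m≡2)
          (sym (*-identityʳ (ι 2)))))))
        where
        w≡δ : w ≡ δℕ m
        w≡δ = trans (sym δ-2w) (trans (cong δ eq) (δ-pos m≤b))
        m≡2 : m ≡ 2
        m≡2 = δℕ-ratio (zone m) m≤b (w≢0 ∘ trans w≡δ) (trans (cong (_* ι 2) (sym w≡δ)) eq)
      position (m , m≤b , inj₂ eq) = w≢-1 (*-cancelˡ two≢0 (trans (*-comm (ι 2) w) (trans eq (trans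
          (cong (-_ ∘ ι) m≡2) (solve 1 (λ x → :- x := x :* :- :1) refl (ι 2))))))
        where
        w≡-δ : w ≡ - δℕ m
        w≡-δ = trans (sym δ-2w) (trans (cong δ eq) (δ-neg m≤b))
        m≡2 : m ≡ 2
        m≡2 = δℕ-ratio (zone m) m≤b (λ δ≡0 → w≢0 (trans w≡-δ (trans (cong -_ δ≡0) -0#≈0#)))
          (linear-combination₂ (- 1#) (ι 2)
              (solve 4 (λ d s w m → d :* s :- m := (:- :1) :* (w :* s :- :- m) :+ s :* (w :- :- d))
              refl (δℕ m) (ι 2) w (ι m)) eq w≡-δ)

-- Exhaustive search for small prime orders.

-- The second inequality says v i - i ≢ v j - j modulo suc n, written without subtraction.
Compatible : ∀ {n} → (Fin (suc n) → Fin (suc n)) → Set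
Compatible {n} v = ∀ i j → i ≢ j → v i ≢ v j × (toℕ (v i) ℕ.+ toℕ j) % suc n ≢ (toℕ (v j) ℕ.+ toℕ i) % suc n

compatible? : ∀ {n} (v : Fin (suc n) → Fin (suc n)) → Dec (Compatible v)
compatible? {n} v = Fin.all? λ i → Fin.all? λ j → ¬? (i Fin.≟ j) →-dec
  (¬? (v i Fin.≟ v j) ×-dec ¬? ((toℕ (v i) ℕ.+ toℕ j) % suc n ℕ.≟ (toℕ (v j) ℕ.+ toℕ i) % suc n))

compatible-resp : ∀ {n} {u v : Fin (suc n) → Fin (suc n)} → u ≗ v → Compatible v → Compatible u
compatible-resp {n} u≗v compatible i j i≢j =
  (λ eq → proj₁ (compatible i j i≢j) (trans (sym (u≗v i)) (trans eq (u≗v j)))) ,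
  (λ eq → proj₂ (compatible i j i≢j) (trans (sum-cong i j) (trans eq (sym (sum-cong j i)))))
  where
  sum-cong = λ i j → cong (λ k → (toℕ k ℕ.+ toℕ j) % suc n) (sym (u≗v i))

Linear : ∀ {n} → (Fin (suc (suc n)) → Fin (suc (suc n))) → Set
Linear {n} v = ∀ i → toℕ (v i) ≡ (toℕ i ℕ.* toℕ (v 1F)) % suc (suc n)

linear? : ∀ {n} (v : Fin (suc (suc n)) → Fin (suc (suc n))) → Dec (Linear v)
linear? {n} v = Fin.all? λ i → toℕ (v i) ℕ.≟ (toℕ i ℕ.* toℕ (v 1F)) % suc (suc n)

linear-resp : ∀ {n} {u v : Fin (suc (suc n)) → Fin (suc (suc n))} → u ≗ v → Linear u → Linear v
linear-resp {n} u≗v linear i = trans (cong toℕ (sym (u≗v i)))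
  (trans (linear i) (cong (λ k → (toℕ i ℕ.* toℕ k) % suc (suc n)) (u≗v 1F)))

table₃ : Fin 3 → Fin 3 → Fin 3 → Fin 3
table₃ x y = lookup (0F ∷ x ∷ y ∷ [])

table₅ : Fin 5 → Fin 5 → Fin 5 → Fin 5 → Fin 5 → Fin 5
table₅ x y z w = lookup (0F ∷ x ∷ y ∷ z ∷ w ∷ [])

neg : ∀ {n} → Fin (suc n) → Fin (suc n)
neg {n} i = (suc n ∸ toℕ i) mod suc n

-- An odd table is determined by three values, which keeps the search to 7 ^ 3 tables.
table₇ : Fin 7 → Fin 7 → Fin 7 → Fin 7 → Fin 7
table₇ x y z = lookup (0F ∷ x ∷ y ∷ z ∷ neg z ∷ neg y ∷ neg x ∷ [])

-- `Compatible` and `Linear` mention residues only, so evaluation over all tables that fix 0 settles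
-- the matter before any field is given.
table₃-linear : ∀ x y → Compatible (table₃ x y) → Linear (table₃ x y)
table₃-linear = from-yes (Fin.all? λ x → Fin.all? λ y → compatible? (table₃ x y) →-dec linear? (table₃ x y))

table₅-linear : ∀ x y z w → Compatible (table₅ x y z w) → Linear (table₅ x y z w)
table₅-linear = from-yes (Fin.all? λ x → Fin.all? λ y → Fin.all? λ z → Fin.all? λ w →
  compatible? (table₅ x y z w) →-dec linear? (table₅ x y z w))

table₇-linear : ∀ x y z → Compatible (table₇ x y z) → Linear (table₇ x y z)
table₇-linear = from-yes (Fin.all? λ x → Fin.all? λ y → Fin.all? λ z →
    compatible? (table₇ x y z) →-dec linear? (table₇ x y z))

-- Fields of prime order in coordinates.

module PrimeField {n : ℕ} (F : FiniteField (suc (suc n))) (q-prime : Prime (suc (suc n))) where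

  open FiniteField F
  open FieldProperties F
  open IntegralElements F
  open ≡-Reasoning

  -- In a Bézout identity a multiple of `d` and a multiple of `q` differ by 1. Both would vanish in
  -- the field, giving 1 = 0.
  ι≢0 : ∀ {d} .{{_ : NonZero d}} → d ℕ.< q → ι d ≢ 0#
  ι≢0 {d} d<q ιd≡0 with coprime-Bézout (prime⇒coprime q-prime d<q)
  ... | Bézout.+- x y eq = 0≢1 (sym (begin
    1#                      ≡⟨ solve 1 (λ y → :1 := (:1 :+ :0) :+ y :* :0) refl (ι y) ⟩
    ι 1 + ι y * 0#          ≡⟨ cong (λ z → ι 1 + ι y * z) ιd≡0 ⟨
    ι 1 + ι y * ι d         ≡⟨ trans (ι-+ 1 (y ℕ.* d)) (cong (ι 1 +_) (ι-* y d)) ⟨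
    ι (1 ℕ.+ y ℕ.* d)       ≡⟨ cong ι eq ⟩
    ι (x ℕ.* q)             ≡⟨ trans (ι-* x q) (trans (cong (ι x *_) characteristic) (zeroʳ _)) ⟩
    0#                      ∎))
  ... | Bézout.-+ x y eq = 0≢1 (sym (begin
    1#                      ≡⟨ solve 1 (λ x → :1 := (:1 :+ :0) :+ x :* :0) refl (ι x) ⟩
    ι 1 + ι x * 0#          ≡⟨ cong (λ z → ι 1 + ι x * z) characteristic ⟨
    ι 1 + ι x * ι q         ≡⟨ trans (ι-+ 1 (x ℕ.* q)) (cong (ι 1 +_) (ι-* x q)) ⟨
    ι (1 ℕ.+ x ℕ.* q)       ≡⟨ cong ι eq ⟩
    ι (y ℕ.* d)             ≡⟨ trans (ι-* y d) (trans (cong (ι y *_) ιd≡0) (zeroʳ _)) ⟩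
    0#                      ∎))

  ι-<-distinct : ∀ {i j} → i ℕ.< j → j ℕ.< q → ι i ≢ ι j
  ι-<-distinct {i} {j} i<j j<q eq = ι≢0 {j ∸ i} {{ℕ.>-nonZero (ℕ.m<n⇒0<n∸m i<j)}} (ℕ.≤-<-trans (ℕ.m∸n≤m j i) j<q)
    (linear-combination₂ (- 1#) 1# (solve 3 (λ i j d → d :- :0 := (:- :1) :* (i :- j) :+ :1 :* (i :+ d :- j))
        refl (ι i) (ι j) (ι (j ∸ i)))
      eq (trans (sym (ι-+ i (j ∸ i))) (cong ι (ℕ.m+[n∸m]≡n (ℕ.<⇒≤ i<j)))))

  ι-injective : Injective _≡_ _≡_ (ι ∘ toℕ {q})
  ι-injective {i} {j} eq with ℕ.<-cmp (toℕ i) (toℕ j)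
  ... | tri< i<j _ _ = contradiction eq (ι-<-distinct i<j (Fin.toℕ<n j))
  ... | tri≈ _ i≡j _ = Fin.toℕ-injective i≡j
  ... | tri> _ _ j<i = contradiction (sym eq) (ι-<-distinct j<i (Fin.toℕ<n i))

  index : Fin q → Fin q
  index x = proj₁ (injective⇒surjective ι-injective x)

  ι-index : ∀ x → ι (toℕ (index x)) ≡ x
  ι-index x = proj₂ (injective⇒surjective ι-injective x)

  module Table {θ : Fin q → Fin q} (orth : IsOrthomorphism θ) (θ0≡0 : θ 0# ≡ 0#) where

    -- The numbering of the carrier by `Fin q` is arbitrary, so `θ` is transported to the residues
    -- along `ι`.
    v : Fin q → Fin q
    v i = index (θ (ι (toℕ i)))

    v-0 : 0F ≡ v 0F
    v-0 = ι-injective (sym (trans (ι-index (θ 0#)) θ0≡0))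

    v-compatible : Compatible v
    v-compatible i j i≢j =
      (λ eq → i≢j (ι-injective (proj₁ (proj₁ orth) (trans (sym (ι-index _)) (trans
          (cong (ι ∘ toℕ) eq) (ι-index _)))))) ,
      (λ eq → i≢j (ι-injective (proj₁ (proj₂ orth) (linear-combination 1#
        (solve 4 (λ s i t j → (s :- i) :- (t :- j) := :1 :* ((s :+ j) :- (t :+ i)))
            refl (θ (ι (toℕ i))) (ι (toℕ i)) (θ (ι (toℕ j))) (ι (toℕ j)))
        (trans (sym (sum-value i j)) (trans (cong ι eq) (sum-value j i)))))))
      where
      sum-value : ∀ i j → ι ((toℕ (v i) ℕ.+ toℕ j) % q) ≡ θ (ι (toℕ i)) + ι (toℕ j)
      sum-value i j = begin
        ι ((toℕ (v i) ℕ.+ toℕ j) % q)     ≡⟨ ι-% (toℕ (v i) ℕ.+ toℕ j) ⟩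
        ι (toℕ (v i) ℕ.+ toℕ j)           ≡⟨ ι-+ (toℕ (v i)) (toℕ j) ⟩
        ι (toℕ (v i)) + ι (toℕ j)         ≡⟨ cong (_+ ι (toℕ j)) (ι-index _) ⟩
        θ (ι (toℕ i)) + ι (toℕ j)         ∎

    v-neg : (∀ x → θ (- x) ≡ - θ x) → ∀ i j → toℕ i ℕ.+ toℕ j ≡ q → neg (v i) ≡ v j
    v-neg θ-odd i j i+j≡q = ι-injective (begin
      ι (toℕ (neg (v i)))         ≡⟨ cong ι (Fin.toℕ-fromℕ< (m%n<n (q ∸ toℕ (v i)) q)) ⟩
      ι ((q ∸ toℕ (v i)) % q)     ≡⟨ ι-% (q ∸ toℕ (v i)) ⟩
      ι (q ∸ toℕ (v i))           ≡⟨ negative (toℕ (v i)) (q ∸ toℕ (v i)) (ℕ.m+[n∸m]≡n (ℕ.<⇒≤ (Fin.toℕ<n (v i)))) ⟩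
      - ι (toℕ (v i))             ≡⟨ cong -_ (ι-index _) ⟩
      - θ (ι (toℕ i))             ≡⟨ θ-odd _ ⟨
      θ (- ι (toℕ i))             ≡⟨ cong θ (negative (toℕ i) (toℕ j) i+j≡q) ⟨
      θ (ι (toℕ j))               ≡⟨ ι-index _ ⟨
      ι (toℕ (v j))               ∎)
      where
      negative : ∀ i j → i ℕ.+ j ≡ q → ι j ≡ - ι i
      negative i j eq = linear-combination 1# (solve 2 (λ i j → j :- :- i := :1 :* (i :+ j :- :0)) refl (ι i) (ι j))
        (trans (sym (ι-+ i j)) (trans (cong ι eq) characteristic))

    -- A linear table means θ x = x θ 1, and multiplications commute with one another.
    linear⇒equivariant : Linear v → ∀ w → Equivariant w θ
    linear⇒equivariant linear w x = begin
      θ (w * x)         ≡⟨ θ-linear (w * x) ⟩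
      w * x * θ (ι 1)   ≡⟨ *-assoc w x _ ⟩
      w * (x * θ (ι 1)) ≡⟨ cong (w *_) (θ-linear x) ⟨
      w * θ x           ∎
      where
      θ-linear : ∀ x → θ x ≡ x * θ (ι 1)
      θ-linear x = begin
        θ x                                         ≡⟨ cong θ (ι-index x) ⟨
        θ (ι (toℕ (index x)))                       ≡⟨ ι-index _ ⟨
        ι (toℕ (v (index x)))                       ≡⟨ cong ι (linear (index x)) ⟩
        ι ((toℕ (index x) ℕ.* toℕ (v 1F)) % q)    ≡⟨ ι-% (toℕ (index x) ℕ.* toℕ (v 1F)) ⟩
        ι (toℕ (index x) ℕ.* toℕ (v 1F))    ≡⟨ ι-* (toℕ (index x)) _ ⟩
        ι (toℕ (index x)) * ι (toℕ (v 1F))  ≡⟨ cong₂ _*_ (ι-index x) (ι-index _) ⟩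
        x * θ (ι 1)                                 ∎

-- The fields of order 3, 5 and 7.

field-of-order-3 : (F : FiniteField 3) → ∀ w → FieldProperties.AllEquivariant F w
field-of-order-3 F w θ orth θ0≡0 = linear⇒equivariant
  (linear-resp table≗v (table₃-linear _ _ (compatible-resp table≗v v-compatible))) w
  where
  open PrimeField F (from-yes (prime? 3))
  open Table orth θ0≡0
  table≗v : table₃ (v 1F) (v 2F) ≗ v
  table≗v 0F = v-0
  table≗v 1F = refl
  table≗v 2F = refl

field-of-order-5 : (F : FiniteField 5) → ∀ w → FieldProperties.AllEquivariant F w
field-of-order-5 F w θ orth θ0≡0 = linear⇒equivariant
  (linear-resp table≗v (table₅-linear _ _ _ _ (compatible-resp table≗v v-compatible))) w
  where
  open PrimeField F (from-yes (prime? 5))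
  open Table orth θ0≡0
  table≗v : table₅ (v 1F) (v 2F) (v 3F) (v 4F) ≗ v
  table≗v 0F = v-0
  table≗v 1F = refl
  table≗v 2F = refl
  table≗v 3F = refl
  table≗v 4F = refl

field-of-order-7 : (F : FiniteField 7) → ∀ w → IntegralElements.OddAllEquivariant F w
field-of-order-7 F w θ orth θ0≡0 θ-odd = linear⇒equivariant
  (linear-resp table≗v (table₇-linear _ _ _ (compatible-resp table≗v v-compatible))) w
  where
  open PrimeField F (from-yes (prime? 7))
  open Table orth θ0≡0
  table≗v : table₇ (v 1F) (v 2F) (v 3F) ≗ v
  table≗v 0F = v-0
  table≗v 1F = refl
  table≗v 2F = refl
  table≗v 3F = refl
  table≗v 4F = v-neg θ-odd 3F 4F refl
  table≗v 5F = v-neg θ-odd 2F 5F refl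
  table≗v 6F = v-neg θ-odd 1F 6F refl

-- Powers of the generator and cyclotomic maps.

module Generator {n : ℕ} (F : FiniteField (suc n)) {g : Fin (suc n)}
                 (gen : FiniteField.IsGenerator F g) (1<n : 1 ℕ.< n) where

  open FiniteField F
  open FieldProperties F
  open IntegralElements F
  open ≡-Reasoning

  instance
    n-nonZero : NonZero n
    n-nonZero = ℕ.>-nonZero (ℕ.<-trans ℕ.z<s 1<n)

  -- For n = 1 the element 0# is a generator, because pow 0# 0 ≡ 1#.
  g≢0 : g ≢ 0#
  g≢0 refl with missed-value {2} (λ { zero → 0# ; (suc zero) → 1# }) (s≤s 1<n)
  ... | x , missed with gen x (missed zero ∘ sym)
  ... | zero  , eq = missed (suc zero) eq
  ... | suc j , eq = missed zero (trans (sym (zeroˡ _)) eq)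

  pow-g≢0 : ∀ i → pow g i ≢ 0#
  pow-g≢0 = pow-nonzero g≢0

  pow-% : ∀ {d} .{{_ : NonZero d}} → pow g d ≡ 1# → ∀ j → pow g (j % d) ≡ pow g j
  pow-% {d} pow≡1 j = begin
    pow g (j % d)                             ≡⟨ *-identityʳ _ ⟨
    pow g (j % d) * 1#                        ≡⟨ cong (pow g (j % d) *_) (trans (cong (λ x →
        pow x (j / d)) pow≡1) (pow-1 (j / d))) ⟨
    pow g (j % d) * pow (pow g d) (j / d)     ≡⟨ cong (pow g (j % d) *_) (pow-* g (j / d) d) ⟨
    pow g (j % d) * pow g (j / d ℕ.* d)       ≡⟨ pow-+ g (j % d) _ ⟨
    pow g (j % d ℕ.+ j / d ℕ.* d)             ≡⟨ cong (pow g) (m≡m%n+[m/n]*n j d) ⟨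
    pow g j                                   ∎

  -- If g ^ d = 1, then 0 and the powers with exponent below `d` already exhaust the field.
  period≥n : ∀ d .{{_ : NonZero d}} → pow g d ≡ 1# → n ℕ.≤ d
  period≥n d pow≡1 = ℕ.≤-pred (surjective⇒≤ {f = f} surj)
    where
    f : Fin (suc d) → Fin (suc n)
    f zero    = 0#
    f (suc i) = pow g (toℕ i)
    surj : StrictlySurjective _≡_ f
    surj y with y Fin.≟ 0#
    ... | yes refl = zero , refl
    ... | no y≢0 with gen y y≢0
    ... | j , refl = suc (fromℕ< (m%n<n j d)) , trans (cong (pow g) (Fin.toℕ-fromℕ< (m%n<n j d))) (pow-% pow≡1 j)

  pow-∸ : ∀ {i j} → i ℕ.≤ j → pow g i ≡ pow g j → pow g (j ∸ i) ≡ 1#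
  pow-∸ {i} {j} i≤j eq = *-cancelˡ (pow-g≢0 i) (begin
    pow g i * pow g (j ∸ i)   ≡⟨ pow-+ g i (j ∸ i) ⟨
    pow g (i ℕ.+ (j ∸ i))     ≡⟨ cong (pow g) (ℕ.m+[n∸m]≡n i≤j) ⟩
    pow g j                   ≡⟨ eq ⟨
    pow g i                   ≡⟨ *-identityʳ _ ⟨
    pow g i * 1#              ∎)

  -- Among the n + 1 exponents from 0 to n, two give the same one of the n non-zero elements. Their
  -- difference is a period of at most `n`, hence equal to `n` by `period≥n`.
  pow-n≡1 : pow g n ≡ 1#
  pow-n≡1 with Fin.pigeonhole (ℕ.n<1+n n) (λ i → punchOut (0≢ i))
    where
    0≢ : (i : Fin (suc n)) → 0# ≢ pow g (toℕ i)
    0≢ i = pow-g≢0 (toℕ i) ∘ sym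
  ... | i , j , i<j , eq = subst (λ d → pow g d ≡ 1#) (ℕ.≤-antisym d≤n (period≥n d pow≡1)) pow≡1
    where
    d = toℕ j ∸ toℕ i
    pow≡1 = pow-∸ (ℕ.<⇒≤ i<j) (Fin.punchOut-injective (pow-g≢0 (toℕ i) ∘ sym) (pow-g≢0 (toℕ j) ∘ sym) eq)
    d≤n : d ℕ.≤ n
    d≤n = ℕ.≤-trans (ℕ.m∸n≤m (toℕ j) (toℕ i)) (Fin.toℕ≤pred[n] j)
    instance
      d-nonZero : NonZero d
      d-nonZero = ℕ.>-nonZero (ℕ.m<n⇒0<n∸m i<j)

  pow≡1⇒∣ : ∀ {k} → pow g k ≡ 1# → n ∣ k
  pow≡1⇒∣ {k} pow≡1 with k % n in eq
  ... | zero  = m%n≡0⇒n∣m k n eq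
  ... | suc r = contradiction (subst (ℕ._< n) eq (m%n<n k n))
    (ℕ.≤⇒≯ (period≥n (suc r) (trans (cong (pow g) (sym eq)) (trans (pow-% pow-n≡1 k) pow≡1))))

  pow≢1 : ∀ {k} .{{_ : NonZero k}} → k ℕ.< n → pow g k ≢ 1#
  pow≢1 k<n pow≡1 = ℕ.<⇒≱ k<n (∣⇒≤ (pow≡1⇒∣ pow≡1))

  cyclotomic⇒equivariant : ∀ k .{{_ : NonZero k}} {θ} → IsCyclotomicMap g k θ → Equivariant (pow g k) θ
  cyclotomic⇒equivariant k {θ} (a , θ0≡0 , θ-pow) x with x Fin.≟ 0#
  ... | yes refl = trans (cong θ (zeroʳ _)) (trans θ0≡0 (sym (trans (cong (pow g k *_) θ0≡0) (zeroʳ _))))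
  ... | no x≢0 with gen x x≢0
  ... | j , refl = begin
    θ (pow g k * pow g j)                   ≡⟨ cong θ (pow-+ g k j) ⟨
    θ (pow g (k ℕ.+ j))                     ≡⟨ θ-pow (k ℕ.+ j) ⟩
    a ((k ℕ.+ j) mod k) * pow g (k ℕ.+ j)   ≡⟨ cong₂ _*_ (cong a mod-eq) (pow-+ g k j) ⟩
    a (j mod k) * (pow g k * pow g j)       ≡⟨ solve 3 (λ a u v → a :* (u :* v) := u :* (a :* v)) refl _ _ _ ⟩
    pow g k * (a (j mod k) * pow g j)       ≡⟨ cong (pow g k *_) (θ-pow j) ⟨
    pow g k * θ (pow g j)                   ∎
    where
    mod-eq : (k ℕ.+ j) mod k ≡ j mod k
    mod-eq = Fin.fromℕ<-cong _ _ (trans (cong (_% k) (ℕ.+-comm k j)) ([m+n]%n≡m%n j k)) _ _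

  -- The multiplier of a class is read off at its representative g ^ i with i < k, and equivariance
  -- carries it along the class.
  equivariant⇒cyclotomic : ∀ k .{{_ : NonZero k}} {θ} → θ 0# ≡ 0# → Equivariant (pow g k) θ → IsCyclotomicMap g k θ
  equivariant⇒cyclotomic k {θ} θ0≡0 eqv = a , θ0≡0 , θ-pow
    where
    a : Fin k → Fin (suc n)
    a i = θ (pow g (toℕ i)) * proj₁ (inverse _ (pow-g≢0 (toℕ i)))
    a-spec : ∀ i → a i * pow g (toℕ i) ≡ θ (pow g (toℕ i))
    a-spec i = linear-combination (θ x)
      (solve 3 (λ t y x → (t :* y) :* x :- t := t :* (x :* y :- :1)) refl (θ x) (proj₁ inv) x)
      (proj₂ inv)
      where
      x = pow g (toℕ i)
      inv = inverse x (pow-g≢0 (toℕ i))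
    θ-pow : ∀ j → θ (pow g j) ≡ a (j mod k) * pow g j
    θ-pow j = begin
      θ (pow g j)             ≡⟨ cong θ split ⟩
      θ (u * v)               ≡⟨ equivariant-pow {θ = θ} eqv (j / k) v ⟩
      u * θ v                 ≡⟨ cong (u *_) (a-spec (j mod k)) ⟨
      u * (a (j mod k) * v)   ≡⟨ solve 3 (λ u a v → u :* (a :* v) := a :* (u :* v)) refl u _ v ⟩
      a (j mod k) * (u * v)   ≡⟨ cong (a (j mod k) *_) split ⟨
      a (j mod k) * pow g j   ∎
      where
      u = pow (pow g k) (j / k)
      v = pow g (toℕ (j mod k))
      split : pow g j ≡ u * v
      split = begin
        pow g j                                   ≡⟨ cong (pow g) (trans (m≡m%n+[m/n]*n j k) (ℕ.+-comm (j % k) _)) ⟩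
        pow g (j / k ℕ.* k ℕ.+ j % k)             ≡⟨ pow-+ g (j / k ℕ.* k) (j % k) ⟩
        pow g (j / k ℕ.* k) * pow g (j % k)       ≡⟨ cong₂ _*_ (pow-* g (j / k) k) (cong (pow g)
            (sym (Fin.toℕ-fromℕ< (m%n<n j k)))) ⟩
        u * v                                     ∎

  -- The inclusion of index b in index a. The reverse inclusion holds whenever a divides b, as g ^ b
  -- is then a power of g ^ a.
  Collapse : ℕ → ℕ → Set
  Collapse a b = ∀ θ → IsOrthomorphism θ → θ 0# ≡ 0# → Equivariant (pow g b) θ → Equivariant (pow g a) θ

  SameCyclotomicOrthomorphisms : (a b : ℕ) .{{_ : NonZero a}} .{{_ : NonZero b}} → Set
  SameCyclotomicOrthomorphisms a b =
    ∀ θ → IsCyclotomicOrthomorphism g a θ ⇔ IsCyclotomicOrthomorphism g b θ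

  same⇒collapse : ∀ a b .{{_ : NonZero a}} .{{_ : NonZero b}} → SameCyclotomicOrthomorphisms a b → Collapse a b
  same⇒collapse a b same θ orth θ0≡0 eqv = cyclotomic⇒equivariant a
    (proj₂ (Equivalence.from (same θ) (orth , equivariant⇒cyclotomic b θ0≡0 eqv)))

  collapse⇒same : ∀ a b .{{_ : NonZero a}} .{{_ : NonZero b}} → a ∣ b → Collapse a b →
      SameCyclotomicOrthomorphisms a b
  collapse⇒same a b (divides c refl) collapse θ = mk⇔
    (λ (orth , cyc@(_ , θ0≡0 , _)) → orth , equivariant⇒cyclotomic b θ0≡0
       (subst (λ w → Equivariant w θ) (sym (pow-* g c a)) (equivariant-pow {θ = θ} (cyclotomic⇒equivariant a cyc) c)))
    (λ (orth , cyc@(_ , θ0≡0 , _)) → orth , equivariant⇒cyclotomic a θ0≡0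
       (collapse θ orth θ0≡0 (cyclotomic⇒equivariant b cyc)))

  -- Two multipliers, for `h` of order at least 3.

  module TwoValued (b : ℕ) .{{_ : NonZero b}} (b∣n : b ∣ n) (2b<n : b ℕ.+ b ℕ.< n) where

    h g⁻¹ h⁻¹ c d : Fin (suc n)
    h = pow g b
    g⁻¹ = proj₁ (inverse g g≢0)
    h⁻¹ = pow g⁻¹ b
    c = 1# + h
    d = 1# + h⁻¹

    h*h⁻¹≡1 : h * h⁻¹ ≡ 1#
    h*h⁻¹≡1 = begin
      h * h⁻¹             ≡⟨ pow-distrib g g⁻¹ b ⟨
      pow (g * g⁻¹) b     ≡⟨ cong (λ x → pow x b) (proj₂ (inverse g g≢0)) ⟩
      pow 1# b            ≡⟨ pow-1 b ⟩
      1#                  ∎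

    -- The order of `h` exceeds 2. That `c` and `d` are non-zero and distinct comes down to this.
    h*h≢1 : h * h ≢ 1#
    h*h≢1 eq = pow≢1 {{ℕ.>-nonZero (ℕ.<-≤-trans (ℕ.>-nonZero⁻¹ b) (ℕ.m≤m+n b b))}} 2b<n (trans (pow-+ g b b) eq)

    h≢0 : h ≢ 0#
    h≢0 = pow-g≢0 b

    h⁻¹≢0 : h⁻¹ ≢ 0#
    h⁻¹≢0 eq = 0≢1 (trans (sym (trans (cong (h *_) eq) (zeroʳ h))) h*h⁻¹≡1)

    c≡h*d : c ≡ h * d
    c≡h*d = linear-combination (- 1#)
        (solve 2 (λ h k → :1 :+ h :- h :* (:1 :+ k) := (:- :1) :* (h :* k :- :1)) refl h h⁻¹) h*h⁻¹≡1

    c≢0 : c ≢ 0#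
    c≢0 eq = h*h≢1 (linear-combination (h - 1#)
        (solve 1 (λ h → h :* h :- :1 := (h :- :1) :* (:1 :+ h :- :0)) refl h) eq)

    d≢0 : d ≢ 0#
    d≢0 eq = c≢0 (trans c≡h*d (trans (cong (h *_) eq) (zeroʳ h)))

    c≢d : c ≢ d
    c≢d eq = h*h≢1 (linear-combination₂ h 1#
        (solve 2 (λ h k → h :* h :- :1 := h :* ((:1 :+ h) :- (:1 :+ k)) :+ :1 :* (h :* k :- :1))
        refl h h⁻¹) eq h*h⁻¹≡1)

    -- The cyclotomy class of 1 of index `b`, described without exponents so that a search over the
    -- field decides it.
    Power : Pred (Fin (suc n)) 0ℓ
    Power x = ∃ λ y → y ≢ 0# × x ≡ pow y b

    Power? : Decidable Power
    Power? x = Fin.any? (λ y → ¬? (y Fin.≟ 0#) ×-dec x Fin.≟ pow y b)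

    power-h* : ∀ {x} → Power x → Power (h * x)
    power-h* (y , y≢0 , refl) = g * y , *-nonzero g≢0 y≢0 , sym (pow-distrib g y b)

    power-h*⁻ : ∀ {x} → Power (h * x) → Power x
    power-h*⁻ {x} (y , y≢0 , hx≡yᵇ) = g⁻¹ * y , *-nonzero g⁻¹≢0 y≢0 , (begin
      x                   ≡⟨ linear-combination (- x)
          (solve 3 (λ x h k → x :- k :* (h :* x) := (:- x) :* (h :* k :- :1)) refl x h h⁻¹) h*h⁻¹≡1 ⟩
      h⁻¹ * (h * x)       ≡⟨ cong (h⁻¹ *_) hx≡yᵇ ⟩
      h⁻¹ * pow y b       ≡⟨ pow-distrib g⁻¹ y b ⟨
      pow (g⁻¹ * y) b     ∎)
      where
      g⁻¹≢0 : g⁻¹ ≢ 0#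
      g⁻¹≢0 eq = 0≢1 (trans (sym (trans (cong (g *_) eq) (zeroʳ g))) (proj₂ (inverse g g≢0)))

    power-1 : Power 1#
    power-1 = 1# , 0≢1 ∘ sym , sym (pow-1 b)

    -- If g ^ i = g ^ m with m = b j, then `n` divides (n - 1) m + i, and so does `b`. The factor g
    -- ^ ((n - 1) m), the inverse of g ^ m, stands in for a subtraction of exponents.
    not-power : ∀ {i} → ¬ b ∣ i → ¬ Power (pow g i)
    not-power {i} b∤i (y , y≢0 , gⁱ≡yᵇ) with gen y y≢0
    ... | j , refl = b∤i (∣m+n∣m⇒∣n (∣-trans b∣n (pow≡1⇒∣ (begin
      pow g (ℕ.pred n ℕ.* m ℕ.+ i)         ≡⟨ pow-+ g (ℕ.pred n ℕ.* m) i ⟩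
      pow g (ℕ.pred n ℕ.* m) * pow g i     ≡⟨ cong (pow g (ℕ.pred n ℕ.* m) *_) (trans gⁱ≡yᵇ (sym (pow-* g b j))) ⟩
      pow g (ℕ.pred n ℕ.* m) * pow g m     ≡⟨ *-comm _ _ ⟩
      pow g m * pow g (ℕ.pred n ℕ.* m)     ≡⟨ pow-+ g m (ℕ.pred n ℕ.* m) ⟨
      pow g (suc (ℕ.pred n) ℕ.* m)         ≡⟨ cong (λ k → pow g (k ℕ.* m)) (ℕ.suc-pred n) ⟩
      pow g (n ℕ.* m)                      ≡⟨ cong (pow g) (ℕ.*-comm n m) ⟩
      pow g (m ℕ.* n)                      ≡⟨ pow-* g m n ⟩
      pow (pow g n) m                      ≡⟨ cong (λ x → pow x m) pow-n≡1 ⟩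
      pow 1# m                             ≡⟨ pow-1 m ⟩
      1#                                   ∎)))
      (∣n⇒∣m*n (ℕ.pred n) (m∣m*n j)))
      where m = b ℕ.* j

    θ : Fin (suc n) → Fin (suc n)
    θ x with Power? x
    ... | yes _ = c * x
    ... | no  _ = d * x

    θ-power : ∀ {x} → Power x → θ x ≡ c * x
    θ-power {x} p with Power? x
    ... | yes _ = refl
    ... | no ¬p = contradiction p ¬p

    θ-nonpower : ∀ {x} → ¬ Power x → θ x ≡ d * x
    θ-nonpower {x} ¬p with Power? x
    ... | yes p = contradiction p ¬p
    ... | no _  = refl

    θ-0 : θ 0# ≡ 0#
    θ-0 with Power? 0#
    ... | yes _ = zeroʳ c
    ... | no _  = zeroʳ d

    θ-equivariant : Equivariant h θ
    θ-equivariant x with Power? x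
    ... | yes p = trans (θ-power (power-h* p)) (solve 3 (λ c h x → c :* (h :* x) := h :* (c :* x)) refl c h x)
    ... | no ¬p = trans (θ-nonpower (¬p ∘ power-h*⁻)) (solve 3 (λ c h x → c :* (h :* x) := h :* (c :* x)) refl d h x)

    -- As c = h d, equal images under different multipliers force the arguments to differ by the
    -- factor `h`. Multiplication by `h` preserves `Power`, so the arguments cannot have had
    -- different multipliers.
    class-shift : ∀ x y → c * x ≡ d * y → h * x ≡ y
    class-shift x y eq = *-cancelˡ d≢0 (begin
      d * (h * x)     ≡⟨ solve 3 (λ h d x → h :* d :* x := d :* (h :* x)) refl h d x ⟨
      h * d * x       ≡⟨ cong (_* x) c≡h*d ⟨
      c * x           ≡⟨ eq ⟩
      d * y           ∎)

    -- The multipliers less 1 are `h` and `h⁻¹`, whose quotient h ^ 2 preserves `Power` as well.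
    difference-class-shift : ∀ x y → h * x ≡ h⁻¹ * y → h * (h * x) ≡ y
    difference-class-shift x y eq = linear-combination₂ h y
      (solve 4 (λ h k x y → h :* (h :* x) :- y := h :* (h :* x :- k :* y) :+ y :* (h :* k :- :1)) refl h h⁻¹ x y)
      eq h*h⁻¹≡1

    θ-injective : Injective _≡_ _≡_ θ
    θ-injective {x} {y} eq with Power? x | Power? y
    ... | yes _ | yes _ = *-cancelˡ c≢0 eq
    ... | no _  | no _  = *-cancelˡ d≢0 eq
    ... | yes p | no ¬p = contradiction (subst Power (class-shift x y eq) (power-h* p)) ¬p
    ... | no ¬p | yes p = contradiction (subst Power (class-shift y x (sym eq)) (power-h* p)) ¬p

    difference : Fin (suc n) → Fin (suc n)
    difference x with Power? x
    ... | yes _ = h * x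
    ... | no  _ = h⁻¹ * x

    θ-difference : ∀ x → θ x - x ≡ difference x
    θ-difference x with Power? x
    ... | yes _ = solve 2 (λ h x → (:1 :+ h) :* x :- x := h :* x) refl h x
    ... | no  _ = solve 2 (λ h x → (:1 :+ h) :* x :- x := h :* x) refl h⁻¹ x

    difference-injective : Injective _≡_ _≡_ difference
    difference-injective {x} {y} eq with Power? x | Power? y
    ... | yes _ | yes _ = *-cancelˡ h≢0 eq
    ... | no _  | no _  = *-cancelˡ h⁻¹≢0 eq
    ... | yes p | no ¬p = contradiction (subst Power (difference-class-shift x y eq) (power-h* (power-h* p))) ¬p
    ... | no ¬p | yes p = contradiction (subst Power (difference-class-shift y x (sym eq)) (power-h* (power-h* p))) ¬p

    θ-orthomorphism : IsOrthomorphism θ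
    θ-orthomorphism = orthomorphism θ-injective
      (λ {x} {y} eq → difference-injective (trans (sym (θ-difference x)) (trans eq (θ-difference y))))

  -- 1 is a b-th power and g ^ a is not, so `θ` has multiplier `c` at 1 and `d` at g ^ a; commuting
  -- with g ^ a would make them equal.
  few-classes-do-not-collapse : ∀ {a b} .{{_ : NonZero b}} → ¬ b ∣ a → b ∣ n → b ℕ.+ b ℕ.< n → ¬ Collapse a b
  few-classes-do-not-collapse {a} {b} b∤a b∣n 2b<n collapse =
    c≢d (sym (*-cancelˡ (pow-g≢0 a) (begin
      pow g a * d               ≡⟨ *-comm _ d ⟩
      d * pow g a               ≡⟨ θ-nonpower (not-power b∤a) ⟨
      θ (pow g a)               ≡⟨ cong θ (*-identityʳ _) ⟨
      θ (pow g a * 1#)          ≡⟨ collapse θ θ-orthomorphism θ-0 θ-equivariant 1# ⟩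
      pow g a * θ 1#            ≡⟨ cong (pow g a *_) (trans (θ-power power-1) (*-identityʳ c)) ⟩
      pow g a * c               ∎)))
    where open TwoValued b b∣n 2b<n

  -- Full index q - 1.

  -- g ^ n = 1, so every map is equivariant under g ^ n.
  collapse⇒allEquivariant : ∀ {a} → Collapse a n → AllEquivariant (pow g a)
  collapse⇒allEquivariant collapse θ orth θ0≡0 = collapse θ orth θ0≡0
    (λ x → trans (cong θ (1*x x)) (sym (1*x (θ x))))
    where
    1*x : ∀ x → pow g n * x ≡ x
    1*x x = trans (cong (_* x) pow-n≡1) (*-identityˡ x)

  -- The two-valued map of index 2 would be additive, so θ (1 + g) = c + d g for the square 1 and
  -- the non-square `g`. As it is also c (1 + g) or d (1 + g), c = d would follow.
  even-order-not-allEquivariant : 2 ∣ n → 4 ℕ.< n → ∀ {w} → w ≢ 1# → w ≢ 0# → ¬ AllEquivariant w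
  even-order-not-allEquivariant 2∣n 4<n w≢1 w≢0 eqv = clash (Power? (1# + g))
    where
    open TwoValued 2 2∣n 4<n
    g-nonpower : ¬ Power g
    g-nonpower p = not-power {1} (λ { (divides zero ()) ; (divides (suc _) ()) }) (subst Power
        (sym (*-identityʳ g)) p)
    sum-value : θ (1# + g) ≡ c + d * g
    sum-value = trans (allEquivariant⇒additive w≢0 w≢1 eqv θ θ-orthomorphism θ-0 1# g)
      (cong₂ _+_ (trans (θ-power power-1) (*-identityʳ c)) (θ-nonpower g-nonpower))
    clash : Dec (Power (1# + g)) → ⊥
    clash (yes p) = c≢d (*-cancelˡ g≢0 (linear-combination 1#
      (solve 3 (λ c d g → g :* c :- g :* d := :1 :* (c :* (:1 :+ g) :- (c :+ d :* g))) refl c d g)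
      (trans (sym (θ-power p)) sum-value)))
    clash (no ¬p) = c≢d (linear-combination (- 1#)
      (solve 3 (λ c d g → c :- d := (:- :1) :* (d :* (:1 :+ g) :- (c :+ d :* g))) refl c d g)
      (trans (sym (θ-nonpower ¬p)) sum-value))

  full-index-does-not-collapse : ∀ {a} .{{_ : NonZero a}} → a ℕ.< n → 4 ℕ.< n → 2 ∣ n ⊎ 1# + 1# ≡ 0# → ¬ Collapse a n
  full-index-does-not-collapse {a} a<n 4<n parity collapse with parity
  ... | inj₁ 2∣n   = even-order-not-allEquivariant 2∣n 4<n (pow≢1 a<n) (pow-g≢0 a) (collapse⇒allEquivariant {a} collapse)
  ... | inj₂ 1+1≡0 = characteristic-2-not-allEquivariant 1+1≡0
      (ℕ.m<n⇒m<1+n 4<n) (pow≢1 a<n) (pow-g≢0 a) (collapse⇒allEquivariant {a} collapse)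

  -- For odd `n`, (-1) ^ n = -1. But -1 is a power of `g`, so (-1) ^ n = 1, and 1 + 1 = 0.
  even-order-or-characteristic-2 : 2 ∣ n ⊎ 1# + 1# ≡ 0#
  even-order-or-characteristic-2 with 1# + 1# Fin.≟ 0#
  ... | yes 1+1≡0 = inj₂ 1+1≡0
  ... | no 1+1≢0 with n % 2 in eq | m≡m%n+[m/n]*n n 2
  ... | zero        | _ = inj₁ (m%n≡0⇒n∣m n 2 eq)
  ... | suc (suc r) | _ = contradiction (subst (ℕ._< 2) eq (m%n<n n 2)) λ { (s≤s (s≤s ())) }
  ... | suc zero    | n≡1+2k with gen (- 1#) (λ eq → 0≢1 (trans (sym -0#≈0#) (trans (cong -_
      (sym eq)) (-‿involutive 1#))))
  ... | j , gʲ≡-1 = contradiction (linear-combination (- 1#)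
      (solve 1 (λ o → o :+ o :- :0 := (:- :1) :* ((:- o) :- o)) refl 1#) -1≡1) 1+1≢0
    where
    k = n / 2
    -1≡1 : - 1# ≡ 1#
    -1≡1 = begin
      - 1#                              ≡⟨ *-identityʳ _ ⟨
      - 1# * 1#                         ≡⟨ cong (- 1# *_) (trans (cong (λ x → pow x k)
          (solve 1 (λ o → (:- :1) :* ((:- :1) :* :1) := :1) refl 1#)) (pow-1 k)) ⟨
      - 1# * pow (pow (- 1#) 2) k       ≡⟨ cong (- 1# *_) (pow-* (- 1#) k 2) ⟨
      pow (- 1#) (1 ℕ.+ k ℕ.* 2)        ≡⟨ cong (pow (- 1#)) n≡1+2k ⟨
      pow (- 1#) n                      ≡⟨ cong (λ x → pow x n) gʲ≡-1 ⟨
      pow (pow g j) n                   ≡⟨ pow-* g n j ⟨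
      pow g (n ℕ.* j)                   ≡⟨ cong (pow g) (ℕ.*-comm n j) ⟩
      pow g (j ℕ.* n)                   ≡⟨ pow-* g j n ⟩
      pow (pow g n) j                   ≡⟨ cong (λ x → pow x j) pow-n≡1 ⟩
      pow 1# j                          ≡⟨ pow-1 j ⟩
      1#                                ∎

  -- Index (q - 1) / 2, where `h` is -1.

  module _ {b : ℕ} .{{_ : NonZero b}} (n≡b+b : n ≡ b ℕ.+ b) where

    b<n : b ℕ.< n
    b<n = subst (b ℕ.<_) (sym n≡b+b) (ℕ.m<m+n b (ℕ.>-nonZero⁻¹ b))

    half-power : pow g b ≡ - 1#
    half-power = square-one (trans (sym (pow-+ g b b)) (trans (cong (pow g) (sym n≡b+b)) pow-n≡1)) (pow≢1 b<n)

    2≢0 : 1# + 1# ≢ 0#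
    2≢0 1+1≡0 = pow≢1 b<n (trans half-power (linear-combination (- 1#)
        (solve 0 (:- :1 :- :1 := (:- :1) :* (:1 :+ :1 :- :0)) refl) 1+1≡0))

    negation : ∀ x → pow g b * x ≡ - x
    negation x = trans (cong (_* x) half-power) (solve 1 (λ x → (:- :1) :* x := :- x) refl x)

    odd⇒equivariant : ∀ {θ} → (∀ x → θ (- x) ≡ - θ x) → Equivariant (pow g b) θ
    odd⇒equivariant {θ} θ-odd x = begin
      θ (pow g b * x)     ≡⟨ cong θ (negation x) ⟩
      θ (- x)             ≡⟨ θ-odd x ⟩
      - θ x               ≡⟨ negation (θ x) ⟨
      pow g b * θ x       ∎

    equivariant⇒odd : ∀ {θ} → Equivariant (pow g b) θ → ∀ x → θ (- x) ≡ - θ x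
    equivariant⇒odd {θ} eqv x = begin
      θ (- x)             ≡⟨ cong θ (negation x) ⟨
      θ (pow g b * x)     ≡⟨ eqv x ⟩
      pow g b * θ x       ≡⟨ negation (θ x) ⟩
      - θ x               ∎

    -- From 0 < a < b, g ^ a is neither 1 nor -1. The counterexample depends on whether the prime
    -- subfield is the whole field.
    half-index-does-not-collapse : ∀ {a} .{{_ : NonZero a}} → a ℕ.< b → 4 ℕ.≤ b → ¬ Collapse a b
    half-index-does-not-collapse {a} a<b 4≤b collapse = refute (Fin.all? Integral?)
      where
      w : Fin q
      w = pow g a
      w≢0 : w ≢ 0#
      w≢0 = pow-g≢0 a
      w≢1 : w ≢ 1#
      w≢1 = pow≢1 (ℕ.<-trans a<b b<n)
      w≢-1 : w ≢ - 1#
      w≢-1 w≡-1 = pow≢1 {b ∸ a} {{ℕ.>-nonZero (ℕ.m<n⇒0<n∸m a<b)}} (ℕ.≤-<-trans (ℕ.m∸n≤m b a) b<n)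
        (pow-∸ (ℕ.<⇒≤ a<b) (trans w≡-1 (sym half-power)))
      odd-equivariant : OddAllEquivariant w
      odd-equivariant θ orth θ0≡0 θ-odd = collapse θ orth θ0≡0 (odd⇒equivariant {θ} θ-odd)
      refute : Dec (∀ x → Integral x) → ⊥
      refute (no ¬integral) = HalfOrder.nonintegral-not-equivariant {b} n≡b+b 2≢0
        (proj₂ (Fin.¬∀⟶∃¬ q Integral Integral? ¬integral)) w≢0 w≢1 w≢-1 odd-equivariant
      refute (yes integral) = not-equivariant w≢0 w≢1 w≢-1 odd-equivariant
        where
        representative : ∀ x → ∃ λ (i : Fin q) → ι (toℕ i) ≡ x
        representative x = Integral-Fin (integral x)
        open Interval F n≡b+b 2≢0 4≤b (toℕ ∘ proj₁ ∘ representative) (Fin.toℕ<n ∘ proj₁ ∘ representative)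
            (proj₂ ∘ representative)
        open WithThird {q / 3} (remainder {s = q / 3} (m%n<n q 3) (m≡m%n+[m/n]*n q 3)) (m≡m%n+[m/n]*n q 3)

  -- Elimination of the non-exceptional parameters.

  -- The cases are the quotients n / b, that is, the orders of `h`. For orders 1 and 2 the
  -- counterexamples start at b = 5 and b = 4, so the smaller `b` are listed; from order 3 on there
  -- is always one.
  collapse⇒exceptional : ∀ {a b} .{{_ : NonZero a}} .{{_ : NonZero b}} → a ℕ.< b → a ∣ b → b ∣ n →
    Collapse a b → Exceptional (suc n) a b
  collapse⇒exceptional {a} {b} a<b a∣b (divides 0 refl) _ = contradiction 1<n λ ()
  collapse⇒exceptional {a} {b} a<b a∣b (divides 1 n≡b) collapse = full-index a<b a∣b (trans n≡b
      (ℕ.*-identityˡ b)) collapse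
    where
    full-index : ∀ {a b} .{{_ : NonZero a}} → a ℕ.< b → a ∣ b → n ≡ b → Collapse a b → Exceptional (suc n) a b
    full-index {b = 0} () _ _ _
    full-index {b = 1} {{nz}} (s≤s z≤n) _ refl _ = contradiction 1<n λ { (s≤s ()) }
    full-index {1} {2} _ _ refl _ = inj₁ (refl , refl , refl)
    full-index {suc (suc _)} {2} (s≤s (s≤s ())) _ _ _
    full-index {1} {3} _ _ refl _ = inj₂ (inj₁ (refl , refl , refl))
    full-index {2} {3} _ 2∣3 _ _ = contradiction 2∣3 (from-no (2 ∣? 3))
    full-index {suc (suc (suc _))} {3} (s≤s (s≤s (s≤s ()))) _ _ _
    full-index {1} {4} _ _ refl _ = inj₂ (inj₂ (inj₂ (inj₁ (refl , refl , refl))))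
    full-index {2} {4} _ _ refl _ = inj₂ (inj₂ (inj₂ (inj₂ (inj₁ (refl , refl , refl)))))
    full-index {3} {4} _ 3∣4 _ _ = contradiction 3∣4 (from-no (3 ∣? 4))
    full-index {suc (suc (suc (suc _)))} {4} (s≤s (s≤s (s≤s (s≤s ())))) _ _ _
    full-index {a} {suc (suc (suc (suc (suc _))))} a<n _ refl collapse =
      contradiction collapse (full-index-does-not-collapse {a} a<n (ℕ.m≤m+n 5 _) even-order-or-characteristic-2)
  collapse⇒exceptional {a} {b} a<b a∣b (divides 2 n≡2b) collapse = half-index a<b a∣b (trans n≡2b (cong (b ℕ.+_)
      (ℕ.+-identityʳ b))) collapse
    where
    half-index : ∀ {a b} .{{_ : NonZero a}} .{{_ : NonZero b}} → a ℕ.< b → a ∣ b → n ≡ b ℕ.+ b → Collapse a b →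
        Exceptional (suc n) a b
    half-index {suc _} {1} (s≤s ()) _ _ _
    half-index {1} {2} _ _ refl _ = inj₂ (inj₂ (inj₁ (refl , refl , refl)))
    half-index {suc (suc _)} {2} (s≤s (s≤s ())) _ _ _
    half-index {1} {3} _ _ refl _ = inj₂ (inj₂ (inj₂ (inj₂ (inj₂ (refl , refl , refl)))))
    half-index {2} {3} _ 2∣3 _ _ = contradiction 2∣3 (from-no (2 ∣? 3))
    half-index {suc (suc (suc _))} {3} (s≤s (s≤s (s≤s ()))) _ _ _
    half-index {a} {suc (suc (suc (suc c)))} a<b _ n≡b+b collapse =
      contradiction collapse (half-index-does-not-collapse n≡b+b {a} a<b (ℕ.m≤m+n 4 c))
  collapse⇒exceptional {a} {b} a<b a∣b b∣n@(divides (suc (suc (suc m))) n≡) collapse =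
    contradiction collapse (few-classes-do-not-collapse {a} {b} (λ b∣a → ℕ.<⇒≱ a<b (∣⇒≤ b∣a)) b∣n
      (subst (b ℕ.+ b ℕ.<_) (sym n≡) (ℕ.+-monoʳ-< b (ℕ.m<m+n b (ℕ.≤-trans (ℕ.>-nonZero⁻¹ b) (ℕ.m≤m+n b (m ℕ.* b)))))))

-- The field of order 4.

-- A non-zero x can have neither 0 nor x as its value, so `θ` permutes 1, g and g ^ 2 without fixed
-- points. It is one of the two 3-cycles, multiplication by `g` or by `g²`.
field-of-order-4 : (F : FiniteField 4) → ∀ {g} → FiniteField.IsGenerator F g → FieldProperties.AllEquivariant F g
field-of-order-4 F {g} gen θ ((inj , _) , (inj′ , _)) θ0≡0 x = equivariant (classify x)
  where
  open FiniteField F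
  open FieldProperties F
  open Generator F gen (s≤s (s≤s z≤n))
  open ≡-Reasoning

  g² : Fin 4
  g² = g * g

  g*g²≡1 : g * g² ≡ 1#
  g*g²≡1 = trans (solve 1 (λ g → g :* (g :* g) := g :* (g :* (g :* :1))) refl g) pow-n≡1

  g≢1 : g ≢ 1#
  g≢1 eq = pow≢1 {1} (s≤s (s≤s z≤n)) (trans (*-identityʳ g) eq)

  data Element : Fin 4 → Set where
    e0  : Element 0#
    e1  : Element 1#
    eg  : Element g
    eg² : Element g²

  power : ∀ {r} → r ℕ.< 3 → Element (pow g r)
  power {0} _ = e1
  power {1} _ = subst Element (sym (*-identityʳ g)) eg
  power {2} _ = subst Element (cong (g *_) (sym (*-identityʳ g))) eg²
  power {suc (suc (suc _))} (s≤s (s≤s (s≤s ())))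

  classify : ∀ x → Element x
  classify x with x Fin.≟ 0#
  ... | yes refl = e0
  ... | no x≢0 with gen x x≢0
  ... | j , refl = subst Element (pow-% pow-n≡1 j) (power (m%n<n j 3))

  fixed⇒0 : ∀ {x} → θ x ≡ x → x ≡ 0#
  fixed⇒0 {x} eq = inj′ (trans (trans (cong (_- x) eq) (-‿inverseʳ x)) (sym (trans
      (cong (_- 0#) θ0≡0) (-‿inverseʳ 0#))))

  value-0⇒0 : ∀ {x} → θ x ≡ 0# → x ≡ 0#
  value-0⇒0 eq = inj (trans eq (sym θ0≡0))

  g²≢0 : g² ≢ 0#
  g²≢0 = *-nonzero g≢0 g≢0

  1≢g² : 1# ≢ g²
  1≢g² eq = g≢1 (trans (sym (*-identityʳ g)) (trans (cong (g *_) eq) g*g²≡1))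

  g≢g² : g ≢ g²
  g≢g² eq = g≢1 (sym (*-cancelˡ g≢0 (trans (*-identityʳ g) eq)))

  -- The values are variables so that their `Element` views can be matched. Two combinations
  -- survive: (g, g ^ 2, 1) and (g ^ 2, 1, g).
  θ-values : ∀ {x y z} → θ 1# ≡ x → θ g ≡ y → θ g² ≡ z → Element x → Element y → Element z →
      y ≡ g * x × z ≡ g * y × x ≡ g * z
  θ-values θ1 _ _ e0 _ _ = contradiction (sym (value-0⇒0 θ1)) 0≢1
  θ-values θ1 _ _ e1 _ _ = contradiction (sym (fixed⇒0 θ1)) 0≢1
  θ-values _ θg _ _ e0 _ = contradiction (value-0⇒0 θg) g≢0
  θ-values _ θg _ _ eg _ = contradiction (fixed⇒0 θg) g≢0
  θ-values _ _ θg² _ _ e0 = contradiction (value-0⇒0 θg²) g²≢0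
  θ-values _ _ θg² _ _ eg² = contradiction (fixed⇒0 θg²) g²≢0
  θ-values θ1 _ θg² eg _ eg = contradiction (inj (trans θ1 (sym θg²))) 1≢g²
  θ-values _ θg θg² eg e1 e1 = contradiction (inj (trans θg (sym θg²))) g≢g²
  θ-values _ _ _ eg eg² e1 = refl , sym g*g²≡1 , sym (*-identityʳ g)
  θ-values θ1 θg _ eg² eg² _ = contradiction (inj (trans θ1 (sym θg))) (g≢1 ∘ sym)
  θ-values _ θg θg² eg² e1 e1 = contradiction (inj (trans θg (sym θg²))) g≢g²
  θ-values _ _ _ eg² e1 eg = sym g*g²≡1 , sym (*-identityʳ g) , refl

  cycle : θ g ≡ g * θ 1# × θ g² ≡ g * θ g × θ 1# ≡ g * θ g²
  cycle = θ-values refl refl refl (classify (θ 1#)) (classify (θ g)) (classify (θ g²))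

  equivariant : ∀ {x} → Element x → θ (g * x) ≡ g * θ x
  equivariant e0  = trans (cong θ (zeroʳ g)) (trans θ0≡0 (sym (trans (cong (g *_) θ0≡0) (zeroʳ g))))
  equivariant e1  = trans (cong θ (*-identityʳ g)) (proj₁ cycle)
  equivariant eg  = proj₁ (proj₂ cycle)
  equivariant eg² = trans (cong θ g*g²≡1) (proj₂ (proj₂ cycle))

-- The exceptional cases and the equivalence.

-- A single element would give 0 = 1, and with two elements b divides 1, which rules out 0 < a < b.
1<q∸1 : ∀ {n} → FiniteField (suc n) → ∀ {a b} .{{_ : NonZero a}} .{{_ : NonZero b}} → a ≢ b → a ∣ b → b ∣ n → 1 ℕ.< n
1<q∸1 {zero} F _ _ _ with FiniteField.0# F in eq₀ | FiniteField.1# F in eq₁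
... | zero | zero = contradiction (trans eq₀ (sym eq₁)) (FiniteField.0≢1 F)
1<q∸1 {suc zero} F {a} {b} a≢b a∣b b∣1 = contradiction (∣⇒≤ b∣1)
  (ℕ.<⇒≱ (ℕ.≤-<-trans (ℕ.>-nonZero⁻¹ a) (proper-divisor-< a≢b a∣b)))
1<q∸1 {suc (suc _)} _ _ _ _ = s≤s (s≤s z≤n)

exceptional⇒collapse : ∀ {n} (F : FiniteField (suc n)) {g} (gen : FiniteField.IsGenerator F g) (1<n : 1 ℕ.< n) →
  ∀ {a b} → Exceptional (suc n) a b → Generator.Collapse F gen 1<n a b
exceptional⇒collapse F _ _ (inj₁ (refl , refl , refl)) θ orth θ0≡0 _ = field-of-order-3 F _ θ orth θ0≡0
exceptional⇒collapse F {g} gen _ (inj₂ (inj₁ (refl , refl , refl))) θ orth θ0≡0 _ =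
  -- The exponent 1 turns equivariance under `g` into that under `pow g 1`.
  FieldProperties.equivariant-pow F {g} {θ} (field-of-order-4 F gen θ orth θ0≡0) 1
exceptional⇒collapse F _ _ (inj₂ (inj₂ (inj₁ (refl , refl , refl)))) θ orth θ0≡0 _ = field-of-order-5 F _ θ orth θ0≡0
exceptional⇒collapse F _ _ (inj₂ (inj₂ (inj₂ (inj₁ (refl ,
    refl , refl))))) θ orth θ0≡0 _ = field-of-order-5 F _ θ orth θ0≡0
exceptional⇒collapse F _ _ (inj₂ (inj₂ (inj₂ (inj₂ (inj₁ (refl ,
    refl , refl)))))) θ orth θ0≡0 _ = field-of-order-5 F _ θ orth θ0≡0
exceptional⇒collapse F gen 1<n (inj₂ (inj₂ (inj₂ (inj₂ (inj₂ (refl , refl , refl)))))) θ orth θ0≡0 eqv =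
  -- b = 3 is half of q - 1 = 6, so equivariance under g ^ 3 is the oddness that the search assumes.
  field-of-order-7 F _ θ orth θ0≡0 (Generator.equivariant⇒odd F gen 1<n {3} refl {θ} eqv)

theorem3p1 : (q : ℕ) → IsPrimePower q → (F : FiniteField q) →
    (g : Fin q) → FiniteField.IsGenerator F g →
    (a b : ℕ) .{{_ : NonZero a}} .{{_ : NonZero b}} → a ≢ b → a ∣ b → b ∣ q ∸ 1 →
    ((∀ (θ : Fin q → Fin q) →
    FiniteField.IsCyclotomicOrthomorphism F g a θ ⇔ FiniteField.IsCyclotomicOrthomorphism F g b θ)
    ⇔ Exceptional q a b)
theorem3p1 (suc n) _ F g gen a b a≢b a∣b b∣n = mk⇔
  (λ same → collapse⇒exceptional (proper-divisor-< a≢b a∣b) a∣b b∣n (same⇒collapse a b same))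
  (λ exceptional → collapse⇒same a b a∣b (exceptional⇒collapse F gen 1<n exceptional))
  where
  1<n : 1 ℕ.< n
  1<n = 1<q∸1 F {a} {b} a≢b a∣b b∣n
  open Generator F gen 1<n
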